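{- Let $f\colon \{0,1\}^n \to \{0,1\}$ be a directional affine extractor for dimension $d$ with bias $\epsilon < \frac12$. Then for every $g\colon \{0,1\}^n \to \{0,1\}$ computed by a strongly read-once linear branching program of size at most $\epsilon \cdot 2^{n-d-1}$, it holds that \[ \operatorname{dist}(f,g) \ge \frac{1-\sqrt{2\epsilon}}{2}. \]
   Context: Identify $\{0,1\}^n$ with $\mathbb{F}_2^n$; addition is over $\mathbb{F}_2$. Linear branching programs. A linear branching program $\mathcal{P}$ in variables $x=(x_1,\dots,x_n)$ is a directed acyclic graph (parallel edges allowed) with exactly one source and two sinks, labeled $0$ and $1$; every inner (non-sink) node is labeled by a linear form over $\mathbb{F}_2$ in $x$, called its query, and has two outgoing edges labeled $0$ and $1$, representing the value of the query. Each input $x\in\{0,1\}^n$ defines a path from the source by following, at each node, the edge labeled with the value of the query on $x$. $\mathcal{P}$ computes $g$ if for every $x$ this path ends in the sink labeled $g(x)$. The size of $\mathcal{P}$ is its number of nodes. For an inner node $v$, $\operatorname{Pre}_v$ is the span of all queries that appear on any path from the source to $v$, excluding the query at $v$; $\operatorname{Post}_v$ is the span of all queries in the subprogram starting at $v$ (including the query at $v$). $\mathcal{P}$ is strongly read-once if for every inner node $v$, $\operatorname{Pre}_v\cap\operatorname{Post}_v=\{0\}$. Directional affine extractors. For $h\colon\{0,1\}^n\to\{0,1\}$ and nonempty $S\subseteq\{0,1\}^n$, $\operatorname{bias}(h|_S) = \left|\mathbb{E}_{x}[(-1)^{h(x)}]\right|$ with $x$ uniform on $S$. $h$ is an affine extractor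 for dimension $d$ with bias $\epsilon$ if $\operatorname{bias}(h|_S)\le\epsilon$ for every affine subspace $S\subseteq\mathbb{F}_2^n$ of dimension $d$. For non-zero $a$, $D_a f(x)=f(x+a)+f(x)$. $f$ is a directional affine extractor for dimension $d$ with bias $\epsilon$ if for every non-zero $a\in\{0,1\}^n$, $D_af$ is an affine extractor for dimension $d$ with bias $\epsilon$. Distance. $\operatorname{dist}(f,g)=|\{x\in\{0,1\}^n: f(x)\ne g(x)\}|/2^n$. -}

module Defs where

open import Data.Bool.Base using (Bool; true; false; _∧_; _xor_; if_then_else_)
open import Data.Fin.Base using (Fin)
open import Data.Integer.Base using (ℤ; +_; -[1+_])
import Data.Integer.Base as ℤ
open import Data.List.Base using (List; []; _∷_; _++_; map; filterᵇ; length; foldr)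
open import Data.Nat.Base as ℕ using (ℕ; zero; suc)
import Data.Nat.Properties as ℕ
open import Data.Product.Base using (∃; ∃-syntax; _×_; _,_; proj₁; proj₂)
open import Data.Rational.Base as ℚ
  using (ℚ; 0ℚ; 1ℚ; ½; _+_; _*_; _-_; -_; _/_; 1/_; _<_; _≤_; _⊔_; Positive; NonNegative)
import Data.Rational.Properties as ℚ
open import Data.Rational.Solver using (module +-*-Solver)
open import Data.Sum.Base using (_⊎_; inj₁; inj₂; [_,_]′)
open import Data.Vec.Base as Vec using (Vec; []; _∷_; zipWith; replicate)
open import Data.Vec.Relation.Unary.All using (All)
open import Function.Base using (_∘_)
open import Function.Bundles using (_⇔_)
open import Relation.Binary.Construct.Closure.ReflexiveTransitive using (Star)
open import Relation.Binary.Construct.Closure.Transitive using (TransClosure)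
open import Relation.Binary.PropositionalEquality
  using (_≡_; _≢_; refl; sym; trans; cong; subst)
open import Relation.Nullary.Decidable.Core using (yes; no)
open import Relation.Nullary.Negation.Core using (¬_)

-- Two-sided Dedekind cuts of ℚ: L q means q < x, and U q means x < q.
record ℝ : Set₁ where
  field
    L U         : ℚ → Set
    L-inhabited : ∃[ q ] L q
    U-inhabited : ∃[ q ] U q
    L-lower     : ∀ {p q} → p < q → L q → L p
    U-upper     : ∀ {p q} → p < q → U p → U q
    L-open      : ∀ {p} → L p → ∃[ q ] (p < q × L q)
    U-open      : ∀ {q} → U q → ∃[ p ] (p < q × U p)
    disjoint    : ∀ {q} → L q → ¬ U q
    located     : ∀ {p q} → p < q → L p ⊎ U q

open ℝ

infix 4 _≤ᴿ_ _<ᴿ_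

_≤ᴿ_ : ℝ → ℝ → Set
x ≤ᴿ y = ∀ q → L x q → L y q

_<ᴿ_ : ℝ → ℝ → Set
x <ᴿ y = ∃[ q ] (U x q × L y q)

private
  p-1<p : ∀ p → p - 1ℚ < p
  p-1<p p = subst (p - 1ℚ <_) (ℚ.+-identityʳ p) (ℚ.+-monoʳ-< p (ℚ.negative⁻¹ (- 1ℚ)))

  p<p+1 : ∀ p → p < p + 1ℚ
  p<p+1 p = subst (_< p + 1ℚ) (ℚ.+-identityʳ p) (ℚ.+-monoʳ-< p (ℚ.positive⁻¹ 1ℚ))

fromℚ : ℚ → ℝ
fromℚ r = record
  { L           = _< r
  ; U           = r <_
  ; L-inhabited = r - 1ℚ , p-1<p r
  ; U-inhabited = r + 1ℚ , p<p+1 r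
  ; L-lower     = ℚ.<-trans
  ; U-upper     = λ p<q r<p → ℚ.<-trans r<p p<q
  ; L-open      = ℚ.<-dense
  ; U-open      = λ r<q → let (p , r<p , p<q) = ℚ.<-dense r<q in p , p<q , r<p
  ; disjoint    = λ q<r r<q → ℚ.<-asym q<r r<q
  ; located     = located-at
  }
  where
  located-at : ∀ {p q} → p < q → p < r ⊎ r < q
  located-at {p} p<q with p ℚ.<? r
  ... | yes p<r = inj₁ p<r
  ... | no  p≮r = inj₂ (ℚ.≤-<-trans (ℚ.≮⇒≥ p≮r) p<q)

private
  reflect : ∀ c {p q} → p < q → c - q < c - p
  reflect c p<q = ℚ.+-monoʳ-< c (ℚ.neg-antimono-< p<q)

  reflect-invol : ∀ c p → c - (c - p) ≡ p
  reflect-invol = solve 2 (λ c p → c :- (c :- p) := p) refl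
    where open +-*-Solver

infixl 6 _⊖_

-- c ⊖ x is the real number c - x.
_⊖_ : ℚ → ℝ → ℝ
c ⊖ x = record
  { L           = λ q → U x (c - q)
  ; U           = λ q → L x (c - q)
  ; L-inhabited = let (p , h) = U-inhabited x in c - p , back (U x) h
  ; U-inhabited = let (p , h) = L-inhabited x in c - p , back (L x) h
  ; L-lower     = λ p<q → U-upper x (reflect c p<q)
  ; U-upper     = λ p<q → L-lower x (reflect c p<q)
  ; L-open      = λ {p} h → let (r , r<c-p , k) = U-open x h in
                    c - r , subst (_< c - r) (reflect-invol c p) (reflect c r<c-p) , back (U x) k
  ; U-open      = λ {q} h → let (r , c-q<r , k) = L-open x h in
                    c - r , subst (c - r <_) (reflect-invol c q) (reflect c c-q<r) , back (L x) k
  ; disjoint    = λ u l → disjoint x l u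
  ; located     = λ p<q → [ inj₂ , inj₁ ]′ (located x (reflect c p<q))
  }
  where
  back : ∀ (P : ℚ → Set) {p} → P p → P (c - (c - p))
  back P {p} = subst P (sym (reflect-invol c p))

infixr 7 _⊛_

-- c ⊛ x is the real number c · x.
_⊛_ : (c : ℚ) .{{_ : Positive c}} → ℝ → ℝ
c ⊛ x = record
  { L           = λ q → L x (c⁻¹ * q)
  ; U           = λ q → U x (c⁻¹ * q)
  ; L-inhabited = let (p , h) = L-inhabited x in c * p , back (L x) h
  ; U-inhabited = let (p , h) = U-inhabited x in c * p , back (U x) h
  ; L-lower     = λ p<q → L-lower x (down p<q)
  ; U-upper     = λ p<q → U-upper x (down p<q)
  ; L-open      = λ {p} h → let (r , lt , k) = L-open x h in
                    c * r , subst (_< c * r) (cancel p) (ℚ.*-monoʳ-<-pos c lt) , back (L x) k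
  ; U-open      = λ {q} h → let (r , lt , k) = U-open x h in
                    c * r , subst (c * r <_) (cancel q) (ℚ.*-monoʳ-<-pos c lt) , back (U x) k
  ; disjoint    = disjoint x
  ; located     = λ p<q → located x (down p<q)
  }
  where
  instance
    c≢0 = ℚ.pos⇒nonZero c
    c⁻¹>0 = ℚ.1/pos⇒pos c
  c⁻¹ = 1/ c
  down : ∀ {p q} → p < q → c⁻¹ * p < c⁻¹ * q
  down = ℚ.*-monoʳ-<-pos c⁻¹
  cancel : ∀ p → c * (c⁻¹ * p) ≡ p
  cancel p = trans (sym (ℚ.*-assoc c c⁻¹ p))
             (trans (cong (_* p) (ℚ.*-inverseʳ c)) (ℚ.*-identityˡ p))
  cancel′ : ∀ p → c⁻¹ * (c * p) ≡ p
  cancel′ p = trans (sym (ℚ.*-assoc c⁻¹ c p))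
              (trans (cong (_* p) (ℚ.*-inverseˡ c)) (ℚ.*-identityˡ p))
  back : ∀ (P : ℚ → Set) {p} → P p → P (c⁻¹ * (c * p))
  back P {p} = subst P (sym (cancel′ p))

private
  p<q⇒0<q-p : ∀ {p q} → p < q → 0ℚ < q - p
  p<q⇒0<q-p {p} {q} p<q = subst (_< q - p) (ℚ.+-inverseʳ p) (ℚ.+-monoˡ-< (- p) p<q)

  *-mono-<-nonNeg : ∀ {p q} → 0ℚ ≤ p → p < q → p * p < q * q
  *-mono-<-nonNeg {p} {q} 0≤p p<q = ℚ.≤-<-trans
    (ℚ.*-monoˡ-≤-nonNeg p {{ℚ.nonNegative 0≤p}} (ℚ.<⇒≤ p<q))
    (ℚ.*-monoˡ-<-pos q {{ℚ.positive (ℚ.≤-<-trans 0≤p p<q)}} p<q)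

  sqrt-above : ∀ {p r} → 0ℚ ≤ p → p * p < r → ∃[ s ] (p < s × s * s ≤ r)
  sqrt-above {p} {r} 0≤p p²<r = s , p<s , s²≤r
    where
    open ℚ.≤-Reasoning
    D = r - p * p
    E = p + p + 1ℚ
    K = D + E
    0<D : 0ℚ < D
    0<D = p<q⇒0<q-p p²<r
    0<E : 0ℚ < E
    0<E = ℚ.+-mono-≤-< (ℚ.+-mono-≤ 0≤p 0≤p) (ℚ.positive⁻¹ 1ℚ)
    instance
      D-pos : Positive D
      D-pos = ℚ.positive 0<D
      K-pos : Positive K
      K-pos = ℚ.pos+pos⇒pos D E {{ℚ.positive 0<E}}
      K-nonZero : ℚ.NonZero K
      K-nonZero = ℚ.pos⇒nonZero K
      1/K-pos : Positive (1/ K)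
      1/K-pos = ℚ.1/pos⇒pos K
    δ = D * 1/ K
    instance
      δ-pos : Positive δ
      δ-pos = ℚ.pos*pos⇒pos D (1/ K)
      δ-nonNeg : NonNegative δ
      δ-nonNeg = ℚ.pos⇒nonNeg δ
    s = p + δ
    p<s : p < s
    p<s = subst (_< s) (ℚ.+-identityʳ p) (ℚ.+-monoʳ-< p (ℚ.positive⁻¹ δ))
    δ≤1 : δ ≤ 1ℚ
    δ≤1 = begin
      D * 1/ K         ≡⟨ cong (_* 1/ K) (ℚ.+-identityʳ D) ⟨
      (D + 0ℚ) * 1/ K  ≤⟨ ℚ.*-monoʳ-≤-nonNeg (1/ K) {{ℚ.pos⇒nonNeg (1/ K)}} (ℚ.+-monoʳ-≤ D (ℚ.<⇒≤ 0<E)) ⟩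
      K * 1/ K         ≡⟨ ℚ.*-inverseʳ K ⟩
      1ℚ               ∎
    E≤K : E ≤ K
    E≤K = begin
      E       ≡⟨ ℚ.+-identityˡ E ⟨
      0ℚ + E  ≤⟨ ℚ.+-monoˡ-≤ E (ℚ.<⇒≤ 0<D) ⟩
      K       ∎
    s²≤r : s * s ≤ r
    s²≤r = begin
      s * s                      ≡⟨ solve 2 (λ p δ → (p :+ δ) :* (p :+ δ) := p :* p :+ δ :* (p :+ p :+ δ)) refl p δ ⟩
      p * p + δ * (p + p + δ)    ≤⟨ ℚ.+-monoʳ-≤ (p * p) (ℚ.*-monoˡ-≤-nonNeg δ (ℚ.+-monoʳ-≤ (p + p) δ≤1)) ⟩
      p * p + δ * E              ≤⟨ ℚ.+-monoʳ-≤ (p * p) (ℚ.*-monoˡ-≤-nonNeg δ E≤K) ⟩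
      p * p + D * 1/ K * K       ≡⟨ cong (λ t → p * p + t) (trans (ℚ.*-assoc D (1/ K) K) (trans (cong (D *_) (ℚ.*-inverseˡ K)) (ℚ.*-identityʳ D))) ⟩
      p * p + (r - p * p)        ≡⟨ solve 2 (λ x r → x :+ (r :- x) := r) refl (p * p) r ⟩
      r                          ∎
      where open +-*-Solver

  sqrt-below : ∀ {q r} → 0ℚ < q → 0ℚ ≤ r → r < q * q → ∃[ s ] (0ℚ < s × s < q × r ≤ s * s)
  sqrt-below {q} {r} 0<q 0≤r r<q² = s , 0<s , s<q , r≤s²
    where
    open ℚ.≤-Reasoning
    D = q * q - r
    K = q + q
    0<D : 0ℚ < D
    0<D = p<q⇒0<q-p r<q²
    instance
      q-pos : Positive q
      q-pos = ℚ.positive 0<q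
      D-pos : Positive D
      D-pos = ℚ.positive 0<D
      K-pos : Positive K
      K-pos = ℚ.pos+pos⇒pos q q
      K-nonZero : ℚ.NonZero K
      K-nonZero = ℚ.pos⇒nonZero K
      1/K-pos : Positive (1/ K)
      1/K-pos = ℚ.1/pos⇒pos K
    δ = D * 1/ K
    instance
      δ-pos : Positive δ
      δ-pos = ℚ.pos*pos⇒pos D (1/ K)
    s = q - δ
    δK≡D : δ * K ≡ D
    δK≡D = trans (ℚ.*-assoc D (1/ K) K) (trans (cong (D *_) (ℚ.*-inverseˡ K)) (ℚ.*-identityʳ D))
    s<q : s < q
    s<q = subst (s <_) (ℚ.+-identityʳ q) (ℚ.+-monoʳ-< q (ℚ.neg-antimono-< (ℚ.positive⁻¹ δ)))
    δ<q : δ < q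
    δ<q = ℚ.*-cancelʳ-<-nonNeg K {{ℚ.pos⇒nonNeg K}} (begin-strict
      δ * K          ≡⟨ δK≡D ⟩
      q * q - r      ≤⟨ ℚ.+-monoʳ-≤ (q * q) (ℚ.neg-antimono-≤ 0≤r) ⟩
      q * q + 0ℚ     <⟨ ℚ.+-monoʳ-< (q * q) (ℚ.positive⁻¹ (q * q) {{ℚ.pos*pos⇒pos q q}}) ⟩
      q * q + q * q  ≡⟨ ℚ.*-distribˡ-+ q q q ⟨
      q * K          ∎)
    0<s : 0ℚ < s
    0<s = p<q⇒0<q-p δ<q
    r≤s² : r ≤ s * s
    r≤s² = begin
      r                                ≡⟨ solve 2 (λ q r → r := q :* q :- (q :* q :- r) :+ con 0ℚ) refl q r ⟩
      q * q - (q * q - r) + 0ℚ         ≤⟨ ℚ.+-monoʳ-≤ (q * q - (q * q - r)) (ℚ.<⇒≤ (ℚ.positive⁻¹ (δ * δ) {{ℚ.pos*pos⇒pos δ δ}})) ⟩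
      q * q - (q * q - r) + δ * δ      ≡⟨ cong (λ t → q * q - t + δ * δ) δK≡D ⟨
      q * q - δ * (q + q) + δ * δ      ≡⟨ solve 2 (λ q δ → q :* q :- δ :* (q :+ q) :+ δ :* δ := (q :- δ) :* (q :- δ)) refl q δ ⟩
      s * s                            ∎
      where open +-*-Solver

-- The square root of max(x, 0).
√_ : ℝ → ℝ
√ x = record
  { L           = λ q → q < 0ℚ ⊎ L x (q * q)
  ; U           = λ q → 0ℚ < q × U x (q * q)
  ; L-inhabited = - 1ℚ , inj₁ (ℚ.negative⁻¹ (- 1ℚ))
  ; U-inhabited = inhabited
  ; L-lower     = lower
  ; U-upper     = λ p<q (0<p , h) →
                    ℚ.<-trans 0<p p<q , U-upper x (*-mono-<-nonNeg (ℚ.<⇒≤ 0<p) p<q) h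
  ; L-open      = λ {p} → open-below p
  ; U-open      = open-above
  ; disjoint    = λ { (inj₁ q<0) (0<q , _) → ℚ.<-asym q<0 0<q
                    ; (inj₂ l)   (_ , u)   → disjoint x l u }
  ; located     = λ {p} {q} → located-at p q
  }
  where
  L-lower′ : ∀ {p q} → p ≤ q → L x q → L x p
  L-lower′ {p} {q} p≤q h with p ℚ.<? q
  ... | yes p<q = L-lower x p<q h
  ... | no  p≮q = subst (L x) (ℚ.≤-antisym (ℚ.≮⇒≥ p≮q) p≤q) h

  U-upper′ : ∀ {p q} → p ≤ q → U x p → U x q
  U-upper′ {p} {q} p≤q h with p ℚ.<? q
  ... | yes p<q = U-upper x p<q h
  ... | no  p≮q = subst (U x) (ℚ.≤-antisym p≤q (ℚ.≮⇒≥ p≮q)) h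

  inhabited : ∃[ q ] (0ℚ < q × U x (q * q))
  inhabited = q , 0<q , U-upper′ p≤q² h
    where
    open ℚ.≤-Reasoning
    p = proj₁ (U-inhabited x)
    h = proj₂ (U-inhabited x)
    q = p ⊔ 1ℚ
    1≤q : 1ℚ ≤ q
    1≤q = ℚ.p≤q⊔p p 1ℚ
    0<q : 0ℚ < q
    0<q = ℚ.<-≤-trans (ℚ.positive⁻¹ 1ℚ) 1≤q
    p≤q² : p ≤ q * q
    p≤q² = begin
      p       ≤⟨ ℚ.p≤p⊔q p 1ℚ ⟩
      q       ≡⟨ ℚ.*-identityʳ q ⟨
      q * 1ℚ  ≤⟨ ℚ.*-monoˡ-≤-nonNeg q {{ℚ.nonNegative (ℚ.<⇒≤ 0<q)}} 1≤q ⟩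
      q * q   ∎

  lower : ∀ {p q} → p < q → q < 0ℚ ⊎ L x (q * q) → p < 0ℚ ⊎ L x (p * p)
  lower p<q (inj₁ q<0) = inj₁ (ℚ.<-trans p<q q<0)
  lower {p} p<q (inj₂ h) with p ℚ.<? 0ℚ
  ... | yes p<0 = inj₁ p<0
  ... | no  p≮0 = inj₂ (L-lower x (*-mono-<-nonNeg (ℚ.≮⇒≥ p≮0) p<q) h)

  open-below : ∀ p → p < 0ℚ ⊎ L x (p * p) → ∃[ q ] (p < q × (q < 0ℚ ⊎ L x (q * q)))
  open-below p h with p ℚ.<? 0ℚ | h
  ... | yes p<0 | _        = let (q , p<q , q<0) = ℚ.<-dense p<0 in q , p<q , inj₁ q<0
  ... | no  p≮0 | inj₁ p<0 = let (q , p<q , q<0) = ℚ.<-dense p<0 in q , p<q , inj₁ q<0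
  ... | no  p≮0 | inj₂ k   =
    let (r , p²<r , l)   = L-open x k
        (s , p<s , s²≤r) = sqrt-above (ℚ.≮⇒≥ p≮0) p²<r
    in s , p<s , inj₂ (L-lower′ s²≤r l)

  open-above : ∀ {q} → 0ℚ < q × U x (q * q) → ∃[ p ] (p < q × 0ℚ < p × U x (p * p))
  open-above {q} (0<q , h) = s , s<q , 0<s , U-upper′ r⊔0≤s² u⁺
    where
    opened = U-open x h
    r = proj₁ opened
    u⁺ : U x (r ⊔ 0ℚ)
    u⁺ = U-upper′ (ℚ.p≤p⊔q r 0ℚ) (proj₂ (proj₂ opened))
    r⊔0<q² : r ⊔ 0ℚ < q * q
    r⊔0<q² with ℚ.⊔-sel r 0ℚ
    ... | inj₁ eq = subst (_< q * q) (sym eq) (proj₁ (proj₂ opened))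
    ... | inj₂ eq = subst (_< q * q) (sym eq) (*-mono-<-nonNeg ℚ.≤-refl 0<q)
    root = sqrt-below 0<q (ℚ.p≤q⊔p r 0ℚ) r⊔0<q²
    s = proj₁ root
    0<s = proj₁ (proj₂ root)
    s<q = proj₁ (proj₂ (proj₂ root))
    r⊔0≤s² = proj₂ (proj₂ (proj₂ root))

  located-at : ∀ p q → p < q → (p < 0ℚ ⊎ L x (p * p)) ⊎ (0ℚ < q × U x (q * q))
  located-at p q p<q with p ℚ.<? 0ℚ
  ... | yes p<0 = inj₁ (inj₁ p<0)
  ... | no  p≮0 with located x (*-mono-<-nonNeg (ℚ.≮⇒≥ p≮0) p<q)
  ...   | inj₁ l = inj₁ (inj₂ l)
  ...   | inj₂ u = inj₂ (ℚ.≤-<-trans (ℚ.≮⇒≥ p≮0) p<q , u)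

2^ℤ : ℤ → ℚ
2^ℤ (+ k)    = + (2 ℕ.^ k) / 1
2^ℤ -[1+ k ] = _/_ (+ 1) (2 ℕ.^ suc k) {{ℕ.m^n≢0 2 (suc k)}}

2^ℤ-positive : ∀ k → Positive (2^ℤ k)
2^ℤ-positive (+ k)    = ℚ.normalize-pos (2 ℕ.^ k) 1 {{_}} {{ℕ.m^n≢0 2 k}}
2^ℤ-positive -[1+ k ] = ℚ.normalize-pos 1 (2 ℕ.^ suc k) {{ℕ.m^n≢0 2 (suc k)}}

infixl 7 _*2^_

_*2^_ : ℝ → ℤ → ℝ
x *2^ k = _⊛_ (2^ℤ k) {{2^ℤ-positive k}} x

-- Bool serves as 𝔽₂, with addition _xor_ and multiplication _∧_.
Cube : ℕ → Set
Cube n = Vec Bool n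

infixl 6 _⊕_
infixr 7 _·_

_⊕_ : ∀ {n} → Cube n → Cube n → Cube n
_⊕_ = zipWith _xor_

𝟎 : ∀ {n} → Cube n
𝟎 = replicate _ false

_·_ : ∀ {n} → Bool → Cube n → Cube n
b · x = Vec.map (b ∧_) x

lincomb : ∀ {n k} → Vec Bool k → Vec (Cube n) k → Cube n
lincomb []       []       = 𝟎
lincomb (c ∷ cs) (v ∷ vs) = (c · v) ⊕ lincomb cs vs

LinearlyIndependent : ∀ {n k} → Vec (Cube n) k → Set
LinearlyIndependent vs = ∀ cs → lincomb cs vs ≡ 𝟎 → cs ≡ 𝟎

Span : ∀ {n} → (Cube n → Set) → Cube n → Set
Span {n} Q x =
  ∃[ k ] ∃[ vs ] (All Q {k} vs × ∃[ cs ] x ≡ lincomb cs vs)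

-- A linear form, given by its coefficient vector.
Form : ℕ → Set
Form n = Vec Bool n

eval : ∀ {n} → Form n → Cube n → Bool
eval q x = Vec.foldr _ _xor_ false (zipWith _∧_ q x)

-- Subsets of the cube are given by their indicator functions.
IsAffineSubspace : ∀ {n} → ℕ → (Cube n → Bool) → Set
IsAffineSubspace {n} d S =
  ∃[ a ] ∃[ vs ] (LinearlyIndependent {n} {d} vs
                  × (∀ x → S x ≡ true ⇔ (∃[ cs ] x ≡ a ⊕ lincomb cs vs)))

allPoints : ∀ n → List (Cube n)
allPoints zero    = [] ∷ []
allPoints (suc n) = map (false ∷_) (allPoints n) ++ map (true ∷_) (allPoints n)

elements : ∀ {n} → (Cube n → Bool) → List (Cube n)
elements {n} S = filterᵇ S (allPoints n)

card : ∀ {n} → (Cube n → Bool) → ℕ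
card S = length (elements S)

sign : Bool → ℤ
sign b = if b then ℤ.-1ℤ else ℤ.1ℤ

bias : ∀ {n} → (Cube n → Bool) → (S : Cube n → Bool) .{{_ : ℕ.NonZero (card S)}} → ℚ
bias h S = ℚ.∣ foldr ℤ._+_ ℤ.0ℤ (map (sign ∘ h) (elements S)) / card S ∣

AffineExtractor : ∀ {n} → ℕ → ℝ → (Cube n → Bool) → Set
AffineExtractor d ε h =
  ∀ S .{{_ : ℕ.NonZero (card S)}} → IsAffineSubspace d S → fromℚ (bias h S) ≤ᴿ ε

D : ∀ {n} → Cube n → (Cube n → Bool) → Cube n → Bool
D a f x = f (x ⊕ a) xor f x

DirectionalAffineExtractor : ∀ {n} → ℕ → ℝ → (Cube n → Bool) → Set
DirectionalAffineExtractor d ε f = ∀ a → a ≢ 𝟎 → AffineExtractor d ε (D a f)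

dist : ∀ {n} → (Cube n → Bool) → (Cube n → Bool) → ℚ
dist {n} f g = _/_ (+ card (λ x → f x xor g x)) (2 ℕ.^ n) {{ℕ.m^n≢0 2 n}}

-- A node of a program with m nodes in n variables. An inner node carries its
-- query and the heads of its two outgoing edges, indexed by their labels.
data Node (n m : ℕ) : Set where
  sink  : Bool → Node n m
  inner : Form n → (Bool → Fin m) → Node n m

Edge : ∀ {n m} → (Fin m → Node n m) → Fin m → Fin m → Set
Edge node u v = ∃[ q ] ∃[ next ] (node u ≡ inner q next × ∃[ b ] next b ≡ v)

record LBP (n : ℕ) : Set where
  field
    size             : ℕ
    node             : Fin size → Node n size
    acyclic          : ∀ v → ¬ TransClosure (Edge node) v v
    source           : Fin size
    source-no-inEdge : ∀ u → ¬ Edge node u source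
    source-unique    : ∀ v → (∀ u → ¬ Edge node u v) → v ≡ source
    sinkOf           : Bool → Fin size
    sinkOf-label     : ∀ b → node (sinkOf b) ≡ sink b
    sinkOf-unique    : ∀ b v → node v ≡ sink b → v ≡ sinkOf b

open LBP

module _ {n : ℕ} (P : LBP n) where

  -- The path of x from v ends in the sink labeled b.
  data Outcome (x : Cube n) (b : Bool) : Fin (size P) → Set where
    stop : ∀ {v} → node P v ≡ sink b → Outcome x b v
    step : ∀ {v q next} → node P v ≡ inner q next →
           Outcome x b (next (eval q x)) → Outcome x b v

  Computes : (Cube n → Bool) → Set
  Computes g = ∀ x → Outcome x (g x) (source P)

  HasQuery : Fin (size P) → Form n → Set
  HasQuery v q = ∃[ next ] node P v ≡ inner q next

  -- The program is acyclic, so the nodes other than v on paths from the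
  -- source to v are the reachable nodes with a nonempty path to v.
  Pre : Fin (size P) → Form n → Set
  Pre v = Span λ q →
    ∃[ u ] (Star (Edge (node P)) (source P) u × TransClosure (Edge (node P)) u v × HasQuery u q)

  Post : Fin (size P) → Form n → Set
  Post v = Span λ q → ∃[ u ] (Star (Edge (node P)) v u × HasQuery u q)

  StronglyReadOnce : Set
  StronglyReadOnce =
    ∀ v q next → node P v ≡ inner q next → ∀ p → Pre v p → Post v p → p ≡ 𝟎

{-# OPTIONS --safe #-}

-- Follow the path of x to the first edge u → v with dim Post_v ≤ d. There dim Pre_u < n − d, and
-- Pre_v ∩ Post_v = 0, so some basis of the linear forms consists of n − d forms φ and d forms ψ
-- such that φ(x) determines whether x takes this edge and, among the inputs that do, g depends
-- on ψ(x) only. Cauchy-Schwarz over the values of ψ then eliminates g and leaves derivatives of f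
-- on affine subspaces of dimension d, so r inputs through one edge have a squared correlation
-- at most r (2^d + ε r). Cauchy-Schwarz over the at most 2·size edges bounds the square of the total
-- correlation by 2^n (2·size·2^d + ε 2^n) ≤ 2 ε 4^n. Bases of Pre_v and Post_v are only obtained
-- under a double negation, which is harmless because the conclusion q < dist f g is decidable.
module Submission where

open import Defs
open import Algebra.Bundles using (CommutativeRing)
import Algebra.Properties.CommutativeSemigroup as CommutativeSemigroupProperties
open import Data.Bool.Base using (Bool; true; false; _∧_; _xor_; if_then_else_)
import Data.Bool.Properties as Bool
open import Data.Fin.Base as Fin using (Fin)
import Data.Fin.Properties as Fin
open import Data.Integer.Base as ℤ using (ℤ; +_; -[1+_]; 0ℤ; 1ℤ; _-_)
import Data.Integer.Properties as ℤ
open import Data.Integer.Tactic.RingSolver using (solve-∀)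
open import Data.List.Base as List using (List; []; _∷_; allFin; cartesianProduct; filterᵇ; length)
open import Data.List.Membership.Propositional using (_∈_)
import Data.List.Membership.Propositional.Properties as List
import Data.List.Properties as List
open import Data.List.Relation.Unary.All as ListAll using ([]; _∷_)
open import Data.List.Relation.Unary.AllPairs using ([]; _∷_)
open import Data.List.Relation.Unary.Any using (here; there)
open import Data.List.Relation.Unary.Unique.Propositional using (Unique)
import Data.List.Relation.Unary.Unique.Propositional.Properties as Unique
open import Data.Nat.Base as ℕ using (ℕ; zero; suc; z≤n; s≤s)
import Data.Nat.Properties as ℕ
open import Data.Product.Base using (∃; ∃-syntax; ∃₂; _×_; _,_; proj₁; proj₂; map₂)
open import Data.Product.Function.NonDependent.Propositional using (_×-↔_)
open import Data.Product.Properties using () renaming (≡-dec to ×-≡-dec)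
open import Data.Rational.Base as ℚ using (ℚ; 0ℚ; 1ℚ; ½; _/_; ↥_; ↧_; ↧ₙ_; 1/_)
open import Data.Rational.Literals using (fromℤ)
import Data.Rational.Properties as ℚ
open import Data.Rational.Solver using (module +-*-Solver)
open import Data.Rational.Unnormalised.Base using (mkℚᵘ; *≡*)
import Data.Rational.Unnormalised.Properties as ℚᵘ
open import Data.Sum.Base using (inj₁; inj₂)
open import Data.Vec.Base as Vec using (Vec; []; _∷_; _++_)
import Data.Vec.Properties as Vec
open import Data.Vec.Relation.Unary.All as All using (All; []; _∷_)
import Data.Vec.Relation.Unary.All.Properties as All
open import Effect.Monad using (RawMonad)
open import Function.Base using (_∘_)
open import Function.Bundles using (Injection; Inverse; _↔_; mk⇔; mk↔ₛ′)
open import Function.Construct.Composition using (_↔-∘_)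
open import Function.Construct.Symmetry using (↔-sym)
open import Function.Definitions using (Injective)
open import Function.Properties.Inverse using (↔⇒↣)
open import Relation.Binary.Construct.Closure.ReflexiveTransitive
  using (Star; _◅_; _◅◅_) renaming (ε to stay)
open import Relation.Binary.Construct.Closure.Transitive using (TransClosure; [_]; _∷_; _∷ʳ_)
open import Relation.Binary.Definitions using (DecidableEquality)
open import Relation.Binary.PropositionalEquality
  using (_≡_; _≢_; refl; sym; trans; cong; cong₂; subst; subst₂; module ≡-Reasoning)
open import Relation.Nullary.Decidable
  using (Dec; yes; no; does; map′; _⊎-dec_; ¬?; dec-true; dec-false; decidable-stable; ¬¬-excluded-middle)
open import Relation.Nullary.Negation using (¬_; contradiction; ¬¬-Monad)

open CommutativeSemigroupProperties
  (CommutativeRing.+-commutativeSemigroup Bool.xor-∧-commutativeRing)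
  using () renaming (interchange to xor-interchange)

-- The number d has two roles. The fibres of φ are parametrised by the d values of ψ, so they have
-- exactly the dimension for which f is an extractor; and since dim Pre + dim Post ≤ n at every
-- node, a node whose Post still exceeds d leaves Pre fewer than n - d dimensions. That strict
-- inequality leaves room for the query at u itself, so φ decides which edge leaves u. The direction
-- in which f is differentiated must not vary over a fibre: two inputs with equal ψ differ by a
-- vector that depends on the difference of their φ values alone. Pairs with equal φ have no
-- direction and contribute trivially; they produce the term r·2^d. The size hypothesis makes the
-- sum of these trivial terms, 2·size·2^d, at most ε·2^n, the same as the extractor term, whence 2ε.
-- The real ε is only ever approached from above, by a rational e = a/b. Multiplying through by b
-- keeps all the counting in the integers.

private
  variable
    n k r s : ℕ

-- Vector arithmetic over 𝔽₂

_≟ᶜ_ : DecidableEquality (Cube n)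
_≟ᶜ_ = Vec.≡-dec Bool._≟_

⊕-comm : (x y : Cube n) → x ⊕ y ≡ y ⊕ x
⊕-comm = Vec.zipWith-comm Bool.xor-comm

⊕-assoc : (x y z : Cube n) → (x ⊕ y) ⊕ z ≡ x ⊕ (y ⊕ z)
⊕-assoc = Vec.zipWith-assoc Bool.xor-assoc

⊕-identityˡ : (x : Cube n) → 𝟎 ⊕ x ≡ x
⊕-identityˡ = Vec.zipWith-identityˡ Bool.xor-identityˡ

⊕-identityʳ : (x : Cube n) → x ⊕ 𝟎 ≡ x
⊕-identityʳ = Vec.zipWith-identityʳ Bool.xor-identityʳ

⊕-self : (x : Cube n) → x ⊕ x ≡ 𝟎
⊕-self []      = refl
⊕-self (b ∷ x) = cong₂ _∷_ (Bool.xor-same b) (⊕-self x)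

⊕-cancel : (x y : Cube n) → x ⊕ (x ⊕ y) ≡ y
⊕-cancel x y = trans (sym (⊕-assoc x x y)) (trans (cong (_⊕ y) (⊕-self x)) (⊕-identityˡ y))

x⊕y≡𝟎⇒x≡y : {x y : Cube n} → x ⊕ y ≡ 𝟎 → x ≡ y
x⊕y≡𝟎⇒x≡y {x = x} {y} eq = begin
  x            ≡⟨ ⊕-identityʳ x ⟨
  x ⊕ 𝟎        ≡⟨ cong (x ⊕_) eq ⟨
  x ⊕ (x ⊕ y)  ≡⟨ ⊕-cancel x y ⟩
  y            ∎
  where open ≡-Reasoning

⊕-interchange : (w x y z : Cube n) → (w ⊕ x) ⊕ (y ⊕ z) ≡ (w ⊕ y) ⊕ (x ⊕ z)
⊕-interchange []      []      []      []      = refl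
⊕-interchange (a ∷ w) (b ∷ x) (c ∷ y) (d ∷ z) =
  cong₂ _∷_ (xor-interchange a b c d) (⊕-interchange w x y z)

·-distribʳ : (a b : Bool) (x : Cube n) → (a xor b) · x ≡ (a · x) ⊕ (b · x)
·-distribʳ a b []      = refl
·-distribʳ a b (c ∷ x) = cong₂ _∷_ (Bool.∧-distribʳ-xor c a b) (·-distribʳ a b x)

true· : (x : Cube n) → true · x ≡ x
true· = Vec.map-id

false· : (x : Cube n) → false · x ≡ 𝟎
false· []      = refl
false· (b ∷ x) = cong (false ∷_) (false· x)

IsAdditive : (Cube k → Cube n) → Set
IsAdditive F = ∀ x y → F (x ⊕ y) ≡ F x ⊕ F y

additive⇒𝟎 : {F : Cube k → Cube n} → IsAdditive F → F 𝟎 ≡ 𝟎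
additive⇒𝟎 {F = F} add = begin
  F 𝟎                ≡⟨ ⊕-cancel (F 𝟎) (F 𝟎) ⟨
  F 𝟎 ⊕ (F 𝟎 ⊕ F 𝟎)  ≡⟨ cong (F 𝟎 ⊕_) (add 𝟎 𝟎) ⟨
  F 𝟎 ⊕ F (𝟎 ⊕ 𝟎)    ≡⟨ cong (λ x → F 𝟎 ⊕ F x) (⊕-self 𝟎) ⟩
  F 𝟎 ⊕ F 𝟎          ≡⟨ ⊕-self (F 𝟎) ⟩
  𝟎                  ∎
  where open ≡-Reasoning

additive-injective : {F : Cube k → Cube n} → IsAdditive F → (∀ x → F x ≡ 𝟎 → x ≡ 𝟎) →
                     Injective _≡_ _≡_ F
additive-injective {F = F} add ker {x} {y} eq = x⊕y≡𝟎⇒x≡y (ker (x ⊕ y) (begin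
  F (x ⊕ y)  ≡⟨ add x y ⟩
  F x ⊕ F y  ≡⟨ cong (_⊕ F y) eq ⟩
  F y ⊕ F y  ≡⟨ ⊕-self (F y) ⟩
  𝟎          ∎))
  where open ≡-Reasoning

lincomb-⊕ : (vs : Vec (Cube n) k) → IsAdditive (λ cs → lincomb cs vs)
lincomb-⊕ []       []       []       = sym (⊕-identityˡ 𝟎)
lincomb-⊕ (v ∷ vs) (c ∷ cs) (d ∷ ds) = begin
  ((c xor d) · v) ⊕ lincomb (cs ⊕ ds) vs                  ≡⟨ cong₂ _⊕_ (·-distribʳ c d v) (lincomb-⊕ vs cs ds) ⟩
  ((c · v) ⊕ (d · v)) ⊕ (lincomb cs vs ⊕ lincomb ds vs)   ≡⟨ ⊕-interchange (c · v) (d · v) _ _ ⟩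
  ((c · v) ⊕ lincomb cs vs) ⊕ ((d · v) ⊕ lincomb ds vs)   ∎
  where open ≡-Reasoning

lincomb-𝟎 : (vs : Vec (Cube n) k) → lincomb 𝟎 vs ≡ 𝟎
lincomb-𝟎 vs = additive⇒𝟎 (lincomb-⊕ vs)

lincomb-false∷ : ∀ (v : Cube n) cs (vs : Vec (Cube n) k) →
                 lincomb (false ∷ cs) (v ∷ vs) ≡ lincomb cs vs
lincomb-false∷ v cs vs = trans (cong (_⊕ lincomb cs vs) (false· v)) (⊕-identityˡ _)

lincomb-true∷ : ∀ (v : Cube n) cs (vs : Vec (Cube n) k) →
                lincomb (true ∷ cs) (v ∷ vs) ≡ v ⊕ lincomb cs vs
lincomb-true∷ v cs vs = cong (_⊕ lincomb cs vs) (true· v)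

lincomb-++ : ∀ cs ds (vs : Vec (Cube n) r) (ws : Vec (Cube n) s) →
             lincomb (cs ++ ds) (vs ++ ws) ≡ lincomb cs vs ⊕ lincomb ds ws
lincomb-++ []       ds []       ws = sym (⊕-identityˡ _)
lincomb-++ (c ∷ cs) ds (v ∷ vs) ws =
  trans (cong ((c · v) ⊕_) (lincomb-++ cs ds vs ws)) (sym (⊕-assoc (c · v) _ _))

-- Over 𝔽₂ additivity already is linearity, so the images of the unit vectors determine the map.
-- This turns the fibres of a coordinate system into cosets in the format of `IsAffineSubspace`.
additive⇒lincomb : {F : Cube k → Cube n} → IsAdditive F →
                   ∃[ vs ] ∀ cs → F cs ≡ lincomb cs vs
additive⇒lincomb {k = zero}  add = [] , λ { [] → additive⇒𝟎 add }
additive⇒lincomb {k = suc k} {F = F} add = v ∷ vs , eq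
  where
  v = F (true ∷ 𝟎)
  tail-additive = additive⇒lincomb {F = λ cs → F (false ∷ cs)} λ x y → add (false ∷ x) (false ∷ y)
  vs = proj₁ tail-additive
  eq : ∀ cs → F cs ≡ lincomb cs (v ∷ vs)
  eq (false ∷ cs) = trans (proj₂ tail-additive cs) (sym (lincomb-false∷ v cs vs))
  eq (true ∷ cs)  = begin
    F (true ∷ cs)           ≡⟨ cong (λ x → F (true ∷ x)) (⊕-identityˡ cs) ⟨
    F (true ∷ 𝟎 ⊕ cs)       ≡⟨ add (true ∷ 𝟎) (false ∷ cs) ⟩
    v ⊕ F (false ∷ cs)      ≡⟨ cong (v ⊕_) (proj₂ tail-additive cs) ⟩
    v ⊕ lincomb cs vs       ≡⟨ lincomb-true∷ v cs vs ⟨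
    lincomb (true ∷ cs) (v ∷ vs) ∎
    where open ≡-Reasoning

any-cube? : {Q : Cube n → Set} → (∀ x → Dec (Q x)) → Dec (∃ Q)
any-cube? {zero}  Q? = map′ ([] ,_) (λ { ([] , q) → q }) (Q? [])
any-cube? {suc n} Q? =
  map′ (λ { (inj₁ (x , q)) → _ , q ; (inj₂ (x , q)) → _ , q })
       (λ { (false ∷ x , q) → inj₁ (x , q) ; (true ∷ x , q) → inj₂ (x , q) })
       (any-cube? (λ x → Q? (false ∷ x)) ⊎-dec any-cube? (λ x → Q? (true ∷ x)))

InSpan : Vec (Cube n) k → Cube n → Set
InSpan vs x = ∃[ cs ] x ≡ lincomb cs vs

inSpan? : (vs : Vec (Cube n) k) (x : Cube n) → Dec (InSpan vs x)
inSpan? vs x = any-cube? λ cs → x ≟ᶜ lincomb cs vs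

-- Counting

cube↔fin : ∀ n → Cube n ↔ Fin (2 ℕ.^ n)
cube↔fin zero    = mk↔ₛ′ (λ _ → Fin.zero) (λ _ → []) (λ { Fin.zero → refl ; (Fin.suc ()) }) (λ { [] → refl })
cube↔fin (suc n) =
  ↔-sym Fin.*↔× ↔-∘ ((↔-sym Fin.2↔Bool ×-↔ cube↔fin n) ↔-∘
    mk↔ₛ′ (λ { (b ∷ x) → b , x }) (λ { (b , x) → b ∷ x }) (λ { (_ , _) → refl }) (λ { (_ ∷ _) → refl }))

injective⇒≤ : {F : Cube r → Cube s} → Injective _≡_ _≡_ F → r ℕ.≤ s
injective⇒≤ {r} {s} inj with r ℕ.≤? s
... | yes r≤s = r≤s
... | no  r≰s = contradiction (Fin.injective⇒≤ (from-injective ∘ inj ∘ to-injective))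
                              (ℕ.<⇒≱ (ℕ.^-monoʳ-< 2 (s≤s (s≤s z≤n)) (ℕ.≰⇒> r≰s)))
  where
  to-injective = Injection.injective (↔⇒↣ (cube↔fin s))
  from-injective = Injection.injective (↔⇒↣ (↔-sym (cube↔fin r)))

-- Pigeonhole on the `suc k` elements `y, F 0, F 1, ...` of `Fin k`: by injectivity the collision
-- has to involve `y`.
finInjective⇒surjective : {F : Fin k → Fin k} → Injective _≡_ _≡_ F → ∀ y → ∃[ x ] F x ≡ y
finInjective⇒surjective {k} {F} inj y
  with Fin.pigeonhole (ℕ.n<1+n k) (λ { Fin.zero → y ; (Fin.suc x) → F x })
... | Fin.zero  , Fin.suc j , i<j     , eq = j , sym eq
... | Fin.suc i , Fin.suc j , s≤s i<j , eq = contradiction (cong Fin.toℕ (inj eq)) (ℕ.<⇒≢ i<j)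

injective⇒surjective : {F : Cube n → Cube n} → Injective _≡_ _≡_ F → ∀ y → ∃[ x ] F x ≡ y
injective⇒surjective {n} {F} inj y =
  let (i , eq) = finInjective⇒surjective (from-injective ∘ inj ∘ to-injective) (to y)
  in from i , to-injective eq
  where
  open Inverse (cube↔fin n) using (to; from)
  to-injective = Injection.injective (↔⇒↣ (cube↔fin n))
  from-injective = Injection.injective (↔⇒↣ (↔-sym (cube↔fin n)))

-- Linear independence and bases

lincomb-injective : {vs : Vec (Cube n) k} → LinearlyIndependent vs →
                    Injective _≡_ _≡_ (λ cs → lincomb cs vs)
lincomb-injective {vs = vs} ind = additive-injective (lincomb-⊕ vs) ind

independent⇒≤ : {vs : Vec (Cube n) k} → LinearlyIndependent vs → k ℕ.≤ n
independent⇒≤ ind = injective⇒≤ (lincomb-injective ind)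

independent⇒spanning : {vs : Vec (Cube n) n} → LinearlyIndependent vs → ∀ x → InSpan vs x
independent⇒spanning ind x =
  let (cs , eq) = injective⇒surjective (lincomb-injective ind) x in cs , sym eq

independent-∷ : {v : Cube n} {vs : Vec (Cube n) k} → LinearlyIndependent vs → ¬ InSpan vs v →
                LinearlyIndependent (v ∷ vs)
independent-∷ {v = v} {vs} ind v∉ (false ∷ cs) eq =
  cong (false ∷_) (ind cs (trans (sym (lincomb-false∷ v cs vs)) eq))
independent-∷ {v = v} {vs} ind v∉ (true ∷ cs) eq =
  contradiction (cs , x⊕y≡𝟎⇒x≡y (trans (sym (lincomb-true∷ v cs vs)) eq)) v∉

-- If every vector were in the span, a choice of coefficients would inject `Cube n` into the smaller
-- `Cube k`.
∃-outside-span : k ℕ.< n → (vs : Vec (Cube n) k) → ∃[ x ] ¬ InSpan vs x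
∃-outside-span k<n vs with any-cube? (λ x → ¬? (inSpan? vs x))
... | yes x∉ = x∉
... | no  none = contradiction (injective⇒≤ coefficients-injective) (ℕ.<⇒≱ k<n)
  where
  span : ∀ x → InSpan vs x
  span x = decidable-stable (inSpan? vs x) (λ x∉ → none (x , x∉))
  coefficients-injective : Injective _≡_ _≡_ (λ x → proj₁ (span x))
  coefficients-injective {x} {y} eq =
    trans (proj₂ (span x)) (trans (cong (λ cs → lincomb cs vs) eq) (sym (proj₂ (span y))))

record Basis (S : Cube n → Set) : Set where
  field
    {dim}       : ℕ
    vectors     : Vec (Cube n) dim
    independent : LinearlyIndependent vectors
    inside      : All S vectors
    spanning    : ∀ {x} → S x → InSpan vectors x

-- A greedy construction. No decision procedure for `S` is assumed, so each question whether some
-- member lies outside the current span is settled by excluded middle under the double negation. The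
-- invariant `n < fuel + k` means that the fuel can run out only once more than n independent
-- vectors are at hand.
¬¬basis : (S : Cube n → Set) → ¬ ¬ Basis S
¬¬basis {n} S = greedy (suc n) [] (λ { [] _ → refl }) [] (ℕ.≤-reflexive (sym (ℕ.+-identityʳ (suc n))))
  where
  greedy : ∀ fuel (vs : Vec (Cube n) k) → LinearlyIndependent vs → All S vs → n ℕ.< fuel ℕ.+ k →
           ¬ ¬ Basis S
  greedy zero vs ind _ n<k _ = ℕ.<⇒≱ n<k (independent⇒≤ ind)
  greedy {k} (suc fuel) vs ind vs∈S n< ¬basis =
    ¬¬-excluded-middle {A = ∃[ v ] S v × ¬ InSpan vs v} λ
    { (yes (v , v∈S , v∉)) →
        greedy fuel (v ∷ vs) (independent-∷ ind v∉) (v∈S ∷ vs∈S)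
          (subst (n ℕ.<_) (sym (ℕ.+-suc fuel k)) n<) ¬basis
    ; (no maximal) → ¬basis record
        { vectors     = vs
        ; independent = ind
        ; inside      = vs∈S
        ; spanning    = λ {x} x∈S → decidable-stable (inSpan? vs x) λ x∉ → maximal (x , x∈S , x∉) }
    }

-- Both families are independent (set the other coefficients to 𝟎) and their spans meet only in 𝟎.
-- In this form the two sides are interchangeable, so either can be enlarged while the other is held
-- fixed.
Independent₂ : Vec (Cube n) r → Vec (Cube n) s → Set
Independent₂ vs ws = ∀ cs ds → lincomb cs vs ≡ lincomb ds ws → cs ≡ 𝟎 × ds ≡ 𝟎

Independent₂-sym : {vs : Vec (Cube n) r} {ws : Vec (Cube n) s} → Independent₂ vs ws → Independent₂ ws vs
Independent₂-sym ind cs ds eq = let (p , q) = ind ds cs (sym eq) in q , p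

𝟎++𝟎 : ∀ r {s} → 𝟎 {r} ++ 𝟎 {s} ≡ 𝟎
𝟎++𝟎 zero    = refl
𝟎++𝟎 (suc r) = cong (false ∷_) (𝟎++𝟎 r)

Independent₂⇒++ : {vs : Vec (Cube n) r} {ws : Vec (Cube n) s} → Independent₂ vs ws →
                  LinearlyIndependent (vs ++ ws)
Independent₂⇒++ {r = r} {vs = vs} {ws} ind cs eq with Vec.splitAt r cs
... | as , bs , refl =
  let (p , q) = ind as bs (x⊕y≡𝟎⇒x≡y (trans (sym (lincomb-++ as bs vs ws)) eq))
  in trans (cong₂ _++_ p q) (𝟎++𝟎 r)

Independent₂-∷ : {v : Cube n} {vs : Vec (Cube n) r} {ws : Vec (Cube n) s} → Independent₂ vs ws →
                 ¬ InSpan (vs ++ ws) v → Independent₂ (v ∷ vs) ws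
Independent₂-∷ {v = v} {vs} {ws} ind v∉ (false ∷ cs) ds eq =
  let (p , q) = ind cs ds (trans (sym (lincomb-false∷ v cs vs)) eq) in cong (false ∷_) p , q
Independent₂-∷ {v = v} {vs} {ws} ind v∉ (true ∷ cs) ds eq = contradiction (cs ++ ds , (begin
  v                                ≡⟨ ⊕-cancel (lincomb cs vs) v ⟨
  lincomb cs vs ⊕ (lincomb cs vs ⊕ v)
    ≡⟨ cong (lincomb cs vs ⊕_) (trans (⊕-comm (lincomb cs vs) v) (trans (sym (lincomb-true∷ v cs vs)) eq)) ⟩
  lincomb cs vs ⊕ lincomb ds ws    ≡⟨ lincomb-++ cs ds vs ws ⟨
  lincomb (cs ++ ds) (vs ++ ws)    ∎)) v∉
  where open ≡-Reasoning

lincomb-closed : {S : Cube n → Set} → S 𝟎 → (∀ {x y} → S x → S y → S (x ⊕ y)) →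
                 ∀ {vs : Vec (Cube n) k} → All S vs → ∀ cs → S (lincomb cs vs)
lincomb-closed         z add []             []           = z
lincomb-closed {S = S} z add {v ∷ vs} (_ ∷ vs∈S) (false ∷ cs) =
  subst S (sym (lincomb-false∷ v cs vs)) (lincomb-closed z add vs∈S cs)
lincomb-closed {S = S} z add {v ∷ vs} (v∈S ∷ vs∈S) (true ∷ cs) =
  subst S (sym (lincomb-true∷ v cs vs)) (add v∈S (lincomb-closed z add vs∈S cs))

Span-lincomb : {Q : Cube n → Set} {vs : Vec (Cube n) k} → All (Span Q) vs →
               ∀ cs → Span Q (lincomb cs vs)
Span-lincomb {n} {Q = Q} = lincomb-closed (0 , [] , [] , [] , refl) add
  where
  add : ∀ {x y} → Span Q x → Span Q y → Span Q (x ⊕ y)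
  add (_ , vs , vs∈Q , cs , refl) (_ , ws , ws∈Q , ds , refl) =
    _ , vs ++ ws , All.++⁺ vs∈Q ws∈Q , cs ++ ds , sym (lincomb-++ cs ds vs ws)

∈⇒Span : {Q : Cube n → Set} {x : Cube n} → Q x → Span Q x
∈⇒Span {x = x} x∈Q = 1 , x ∷ [] , x∈Q ∷ [] , true ∷ [] ,
  sym (trans (lincomb-true∷ x [] []) (⊕-identityʳ x))

-- Forms and coordinates

eval-𝟎ˡ : (x : Cube n) → eval 𝟎 x ≡ false
eval-𝟎ˡ []      = refl
eval-𝟎ˡ (b ∷ x) = eval-𝟎ˡ x

eval-⊕ˡ : (p q : Form n) (x : Cube n) → eval (p ⊕ q) x ≡ eval p x xor eval q x
eval-⊕ˡ []      []      []      = refl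
eval-⊕ˡ (a ∷ p) (b ∷ q) (c ∷ x) =
  trans (cong₂ _xor_ (Bool.∧-distribʳ-xor c a b) (eval-⊕ˡ p q x)) (xor-interchange (a ∧ c) (b ∧ c) _ _)

eval-⊕ʳ : (p : Form n) (x y : Cube n) → eval p (x ⊕ y) ≡ eval p x xor eval p y
eval-⊕ʳ []      []      []      = refl
eval-⊕ʳ (a ∷ p) (b ∷ x) (c ∷ y) =
  trans (cong₂ _xor_ (Bool.∧-distribˡ-xor a b c) (eval-⊕ʳ p x y)) (xor-interchange (a ∧ b) (a ∧ c) _ _)

eval-nondegenerate : (x : Cube n) → (∀ p → eval p x ≡ false) → x ≡ 𝟎
eval-nondegenerate []      _    = refl
eval-nondegenerate (b ∷ x) zero! = cong₂ _∷_
  (trans (sym (trans (cong (b xor_) (eval-𝟎ˡ x)) (Bool.xor-identityʳ b))) (zero! (true ∷ 𝟎)))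
  (eval-nondegenerate x λ p → zero! (false ∷ p))

evals : Vec (Form n) k → Cube n → Cube k
evals φ x = Vec.map (λ p → eval p x) φ

evals-⊕ : (φ : Vec (Form n) k) → IsAdditive (evals φ)
evals-⊕ []      x y = refl
evals-⊕ (p ∷ φ) x y = cong₂ _∷_ (eval-⊕ʳ p x y) (evals-⊕ φ x y)

eval-lincomb : ∀ cs (φ : Vec (Form n) k) x → eval (lincomb cs φ) x ≡ eval cs (evals φ x)
eval-lincomb []       []      x = eval-𝟎ˡ x
eval-lincomb (c ∷ cs) (p ∷ φ) x =
  trans (eval-⊕ˡ (c · p) (lincomb cs φ) x) (cong₂ _xor_ (scale c) (eval-lincomb cs φ x))
  where
  scale : ∀ c → eval (c · p) x ≡ c ∧ eval p x
  scale false = trans (cong (λ q → eval q x) (false· p)) (eval-𝟎ˡ x)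
  scale true  = cong (λ q → eval q x) (true· p)

InSpan-eval : {φ : Vec (Form n) k} {p : Form n} {x y : Cube n} → InSpan φ p →
              evals φ x ≡ evals φ y → eval p x ≡ eval p y
InSpan-eval {φ = φ} {x = x} {y} (cs , refl) eq =
  trans (eval-lincomb cs φ x) (trans (cong (eval cs) eq) (sym (eval-lincomb cs φ y)))

-- The forms in φ and ψ together are linear coordinates on the cube: `point` is the additive inverse
-- of the map from x to (φ(x), ψ(x)).
record Coordinates {n m d} (φ : Vec (Form n) m) (ψ : Vec (Form n) d) : Set where
  field
    point     : Cube m → Cube d → Cube n
    φ-point   : ∀ y z → evals φ (point y z) ≡ y
    ψ-point   : ∀ y z → evals ψ (point y z) ≡ z
    point-φψ  : ∀ x → point (evals φ x) (evals ψ x) ≡ x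
    point-⊕   : ∀ y z y′ z′ → point y z ⊕ point y′ z′ ≡ point (y ⊕ y′) (z ⊕ z′)

  point-injective : ∀ {y z y′ z′} → point y z ≡ point y′ z′ → y ≡ y′ × z ≡ z′
  point-injective {y} {z} {y′} {z′} eq =
    trans (sym (φ-point y z)) (trans (cong (evals φ) eq) (φ-point y′ z′)) ,
    trans (sym (ψ-point y z)) (trans (cong (evals ψ) eq) (ψ-point y′ z′))

  point-𝟎 : point 𝟎 𝟎 ≡ 𝟎
  point-𝟎 = trans (sym (⊕-cancel (point 𝟎 𝟎) (point 𝟎 𝟎)))
    (trans (cong (point 𝟎 𝟎 ⊕_) (trans (point-⊕ 𝟎 𝟎 𝟎 𝟎) (cong₂ point (⊕-self 𝟎) (⊕-self 𝟎))))
           (⊕-self (point 𝟎 𝟎)))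

  -- The directions `ks` span the common kernel of φ and hence serve all y at once: every fibre of φ
  -- is a translate of the same d-dimensional subspace.
  fibre : ∃[ ks ] LinearlyIndependent {n} {d} ks × (∀ y z → point y z ≡ point y 𝟎 ⊕ lincomb z ks)
  fibre = ks , independent , translate
    where
    H : Cube d → Cube n
    H = point 𝟎
    H-additive : IsAdditive H
    H-additive z z′ = sym (trans (point-⊕ 𝟎 z 𝟎 z′) (cong (λ y → point y (z ⊕ z′)) (⊕-self 𝟎)))
    ks = proj₁ (additive⇒lincomb H-additive)
    H≗ = proj₂ (additive⇒lincomb H-additive)
    independent : LinearlyIndependent ks
    independent z eq = proj₂ (point-injective (trans (H≗ z) (trans eq (sym point-𝟎))))
    translate : ∀ y z → point y z ≡ point y 𝟎 ⊕ lincomb z ks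
    translate y z = begin
      point y z              ≡⟨ cong₂ point (⊕-identityʳ y) (⊕-identityˡ z) ⟨
      point (y ⊕ 𝟎) (𝟎 ⊕ z)  ≡⟨ point-⊕ y 𝟎 𝟎 z ⟨
      point y 𝟎 ⊕ H z        ≡⟨ cong (point y 𝟎 ⊕_) (H≗ z) ⟩
      point y 𝟎 ⊕ lincomb z ks ∎
      where open ≡-Reasoning

-- As many independent forms as variables span all forms, so a point where they all vanish is killed
-- by every form and is 𝟎. The evaluation map is therefore injective, and by finiteness bijective.
coordinates : ∀ {m d} {φ : Vec (Form (m ℕ.+ d)) m} {ψ : Vec (Form (m ℕ.+ d)) d} →
              Independent₂ φ ψ → Coordinates φ ψ
coordinates {m} {d} {φ} {ψ} ind = record
  { point    = λ y z → preimage (y ++ z)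
  ; φ-point  = λ y z → proj₁ (split y z)
  ; ψ-point  = λ y z → proj₂ (split y z)
  ; point-φψ = λ x → injective (trans (evals-preimage _) (sym (Vec.map-++ _ φ ψ)))
  ; point-⊕  = λ y z y′ z′ → injective (begin
      evals θ (preimage (y ++ z) ⊕ preimage (y′ ++ z′))  ≡⟨ evals-⊕ θ _ _ ⟩
      evals θ (preimage (y ++ z)) ⊕ evals θ (preimage (y′ ++ z′))
        ≡⟨ cong₂ _⊕_ (evals-preimage (y ++ z)) (evals-preimage (y′ ++ z′)) ⟩
      (y ++ z) ⊕ (y′ ++ z′)                              ≡⟨ Vec.zipWith-++ _xor_ y z y′ z′ ⟩
      (y ⊕ y′) ++ (z ⊕ z′)                               ≡⟨ evals-preimage _ ⟨
      evals θ (preimage ((y ⊕ y′) ++ (z ⊕ z′)))          ∎)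
  }
  where
  open ≡-Reasoning
  θ = φ ++ ψ
  injective : Injective _≡_ _≡_ (evals θ)
  injective = additive-injective (evals-⊕ θ) λ x eq → eval-nondegenerate x λ p →
    let p∈θ = independent⇒spanning (Independent₂⇒++ ind) p
    in trans (InSpan-eval p∈θ (trans eq (sym (additive⇒𝟎 (evals-⊕ θ))))) (eval-𝟎ʳ p)
    where
    eval-𝟎ʳ : ∀ {n} (p : Form n) → eval p 𝟎 ≡ false
    eval-𝟎ʳ []      = refl
    eval-𝟎ʳ (b ∷ p) = trans (cong (_xor eval p 𝟎) (Bool.∧-zeroʳ b)) (eval-𝟎ʳ p)
  preimage : Cube (m ℕ.+ d) → Cube (m ℕ.+ d)
  preimage w = proj₁ (injective⇒surjective injective w)
  evals-preimage : ∀ w → evals θ (preimage w) ≡ w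
  evals-preimage w = proj₂ (injective⇒surjective injective w)
  split : ∀ y z → evals φ (preimage (y ++ z)) ≡ y × evals ψ (preimage (y ++ z)) ≡ z
  split y z = Vec.++-injective _ y (trans (sym (Vec.map-++ _ φ ψ)) (evals-preimage (y ++ z)))

-- Here i counts the missing forms; while one is missing, `r + s < n` provides a form outside both
-- spans. The last clause remembers that the original forms are among those of φ.
extend : ∀ {m} i → i ℕ.+ r ≡ m → m ℕ.+ s ℕ.≤ n → (vs : Vec (Form n) r) (ws : Vec (Form n) s) →
         Independent₂ vs ws →
         ∃[ φ ] Independent₂ {r = m} φ ws × (∀ {x y} → evals φ x ≡ evals φ y → evals vs x ≡ evals vs y)
extend zero refl _ vs ws ind = vs , ind , λ eq → eq
extend {r} {s} {n} (suc i) refl m+s≤n vs ws ind =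
  let (v , v∉) = ∃-outside-span (ℕ.≤-trans (ℕ.+-monoˡ-≤ s (s≤s (ℕ.m≤n+m r i))) m+s≤n) (vs ++ ws)
      (φ , ind′ , agree) = extend i (ℕ.+-suc i r) m+s≤n (v ∷ vs) ws (Independent₂-∷ ind v∉)
  in φ , ind′ , λ eq → Vec.∷-injectiveʳ (agree eq)

extend-to-coordinates : ∀ {m d} → r ℕ.≤ m → s ℕ.≤ d →
  (vs : Vec (Form (m ℕ.+ d)) r) (ws : Vec (Form (m ℕ.+ d)) s) → Independent₂ vs ws →
  ∃[ φ ] ∃[ ψ ] Coordinates {m = m} {d} φ ψ ×
    (∀ {x y} → evals φ x ≡ evals φ y → evals vs x ≡ evals vs y) ×
    (∀ {x y} → evals ψ x ≡ evals ψ y → evals ws x ≡ evals ws y)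
extend-to-coordinates {m = m} {d} r≤m s≤d vs ws ind =
  let (φ , ind₁ , agree₁) = extend _ (ℕ.m∸n+n≡m r≤m) (ℕ.+-monoʳ-≤ m s≤d) vs ws ind
      (ψ , ind₂ , agree₂) = extend _ (ℕ.m∸n+n≡m s≤d) (ℕ.≤-reflexive (ℕ.+-comm d m)) ws φ (Independent₂-sym ind₁)
  in φ , ψ , coordinates (Independent₂-sym ind₂) , agree₁ , agree₂

-- Cutting a strongly read-once program

Span-trivial : {Q : Cube n → Set} → (∀ x → Q x → x ≡ 𝟎) → ∀ x → Span Q x → x ≡ 𝟎
Span-trivial {Q = Q} trivial x (_ , vs , vs∈Q , cs , refl) =
  lincomb-closed refl (λ { refl refl → ⊕-self 𝟎 }) (All.map (λ {v} → trivial v) vs∈Q) cs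

independent⇒≢𝟎 : {v : Cube n} {vs : Vec (Cube n) k} → LinearlyIndependent (v ∷ vs) → v ≢ 𝟎
independent⇒≢𝟎 {v = v} {vs} ind refl
  with () ← ind (true ∷ 𝟎) (trans (lincomb-true∷ v 𝟎 vs) (trans (cong (v ⊕_) (lincomb-𝟎 vs)) (⊕-self 𝟎)))

dim-trivial : {S : Cube n → Set} → (∀ x → S x → x ≡ 𝟎) → (B : Basis S) → Basis.dim B ≡ 0
dim-trivial trivial record { vectors = [] }                                      = refl
dim-trivial trivial record { vectors = v ∷ vs ; independent = ind ; inside = v∈S ∷ _ } =
  contradiction (trivial v v∈S) (independent⇒≢𝟎 ind)

disjoint⇒Independent₂ : {Q R : Cube n → Set} → (∀ x → Span Q x → Span R x → x ≡ 𝟎) →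
                        {vs : Vec (Cube n) r} {ws : Vec (Cube n) s} →
                        LinearlyIndependent vs → LinearlyIndependent ws →
                        All (Span Q) vs → All (Span R) ws → Independent₂ vs ws
disjoint⇒Independent₂ {R = R} disjoint {vs} {ws} vs-ind ws-ind vs∈ ws∈ cs ds eq =
  vs-ind cs both≡𝟎 , ws-ind ds (trans (sym eq) both≡𝟎)
  where
  both≡𝟎 : lincomb cs vs ≡ 𝟎
  both≡𝟎 = disjoint _ (Span-lincomb vs∈ cs) (subst (Span R) (sym eq) (Span-lincomb ws∈ ds))

InSpan-∷ : {v x : Cube n} {vs : Vec (Cube n) k} → InSpan vs x → InSpan (v ∷ vs) x
InSpan-∷ {v = v} {vs = vs} (cs , eq) = false ∷ cs , trans eq (sym (lincomb-false∷ v cs vs))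

-- Serves to add the query at the cut node to a basis of its Pre. The case distinction is there
-- because that query may be the zero form, which adds no dimension.
adjoin : {S : Cube n → Set} {vs : Vec (Cube n) k} → LinearlyIndependent vs → All S vs → ∀ {q} → S q →
         ∃₂ λ r (ws : Vec (Cube n) r) → r ℕ.≤ suc k × LinearlyIndependent ws × All S ws ×
           (∀ {x} → InSpan vs x → InSpan ws x) × InSpan ws q
adjoin {k = k} {vs = vs} ind vs∈S {q} q∈S with inSpan? vs q
... | yes q∈ = k , vs , ℕ.n≤1+n k , ind , vs∈S , (λ x∈ → x∈) , q∈
... | no  q∉ = suc k , q ∷ vs , ℕ.≤-refl , independent-∷ ind q∉ , q∈S ∷ vs∈S , InSpan-∷ ,
  (true ∷ 𝟎 , sym (trans (lincomb-true∷ q 𝟎 vs) (trans (cong (q ⊕_) (lincomb-𝟎 vs)) (⊕-identityʳ q))))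

Span-mono : {Q R : Cube n → Set} → (∀ {x} → Q x → R x) → ∀ {x} → Span Q x → Span R x
Span-mono Q⊆R (k , vs , vs∈Q , cs , eq) = k , vs , All.map Q⊆R vs∈Q , cs , eq

-- All that the correlation bound sees of the program: each part is a union of fibres of φ, and on
-- it g factors through ψ. The coordinates vary with the part, and asking for them at a point x₀
-- restricts the demand to nonempty parts.
record Partition {m d : ℕ} (g : Cube (m ℕ.+ d) → Bool) (I : Set) : Set where
  field
    part : Cube (m ℕ.+ d) → I
    part-coordinates : ∀ x₀ → ∃[ φ ] ∃[ ψ ] Coordinates {m = m} {d} φ ψ ×
      (∀ {x y} → part x ≡ part x₀ → evals φ x ≡ evals φ y → part y ≡ part x₀) ×
      (∀ {x y} → part x ≡ part x₀ → part y ≡ part x₀ → evals ψ x ≡ evals ψ y → g x ≡ g y)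

module _ {n : ℕ} (P : LBP n) where
  open LBP P

  outcome-agree : ∀ {x y a b v} → (∀ {u q} → Star (Edge node) v u → HasQuery P u q → eval q x ≡ eval q y) →
                  Outcome P x a v → Outcome P y b v → a ≡ b
  outcome-agree agree (stop eq) (stop eq′) with refl ← trans (sym eq) eq′ = refl
  outcome-agree agree (stop eq) (step eq′ _) with () ← trans (sym eq) eq′
  outcome-agree agree (step eq _) (stop eq′) with () ← trans (sym eq) eq′
  outcome-agree {x} {y} {b = b} agree (step {q = q} {next} eq o) (step eq′ o′) with refl ← trans (sym eq) eq′ =
    outcome-agree (λ path → agree ((q , next , eq , _ , refl) ◅ path)) o
      (subst (λ c → Outcome P y b (next c)) (sym (agree stay (next , eq))) o′)

module Cuts {m d : ℕ} (P : LBP (m ℕ.+ d)) (0<m : 0 ℕ.< m)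
            (readOnce : StronglyReadOnce P)
            (pre : ∀ v → Basis (Pre P v)) (post : ∀ v → Basis (Post P v)) where
  open LBP P
  open Basis

  _⟶*_ : Fin size → Fin size → Set
  _⟶*_ = Star (Edge node)

  PreQuery : Fin size → Form (m ℕ.+ d) → Set
  PreQuery v q = ∃[ u ] (source ⟶* u × TransClosure (Edge node) u v × HasQuery P u q)

  Post-sink : ∀ {v b} → node v ≡ sink b → ∀ p → Post P v p → p ≡ 𝟎
  Post-sink {v} eq = Span-trivial λ { q (u , path , query) → contradiction query (no-query path) }
    where
    no-query : ∀ {u q} → v ⟶* u → ¬ HasQuery P u q
    no-query stay                      (_ , eq′) with () ← trans (sym eq) eq′
    no-query ((_ , _ , eq′ , _) ◅ _) _           with () ← trans (sym eq) eq′

  -- Strong read-onceness speaks of inner nodes, but the head of a cut edge may be a sink. There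
  -- Post is trivial, because no query follows.
  Pre∩Post : ∀ v p → Pre P v p → Post P v p → p ≡ 𝟎
  Pre∩Post v p p∈Pre p∈Post with node v in eq
  ... | sink b       = Post-sink eq p p∈Post
  ... | inner q next = readOnce v q next eq p p∈Pre p∈Post

  Pre-source : ∀ p → Pre P source p → p ≡ 𝟎
  Pre-source = Span-trivial λ { _ (_ , _ , path , _) → contradiction path no-path }
    where
    no-path : ∀ {u} → ¬ TransClosure (Edge node) u source
    no-path [ e ]      = source-no-inEdge _ e
    no-path (_ ∷ path) = no-path path

  -- The only dimension count in the argument: bases of two subspaces with trivial intersection form
  -- one independent family. It converts `dim (post v) > d` into `dim (pre v) < m`.
  dim-pre+dim-post≤ : ∀ v → dim (pre v) ℕ.+ dim (post v) ℕ.≤ m ℕ.+ d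
  dim-pre+dim-post≤ v = independent⇒≤ (Independent₂⇒++
    (disjoint⇒Independent₂ (Pre∩Post v) (independent (pre v)) (independent (post v))
                           (inside (pre v)) (inside (post v))))

  -- Cut x v (u , b): on the path of x from v, the edge labeled b out of u is the first one
  -- whose head has a Post of dimension at most d. The label false in at-sink is a dummy.
  data Cut (x : Cube (m ℕ.+ d)) : Fin size → Fin size × Bool → Set where
    at-sink : ∀ {v b} → node v ≡ sink b → Cut x v (v , false)
    here    : ∀ {v q next} → node v ≡ inner q next → dim (post (next (eval q x))) ℕ.≤ d →
              Cut x v (v , eval q x)
    there   : ∀ {v q next e} → node v ≡ inner q next → d ℕ.< dim (post (next (eval q x))) →
              Cut x (next (eval q x)) e → Cut x v e

  cut : ∀ {x b v} → Outcome P x b v → ∃ (Cut x v)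
  cut (stop eq) = _ , at-sink eq
  cut {x} (step {q = q} {next} eq o) with dim (post (next (eval q x))) ℕ.≤? d
  ... | yes ≤d = _ , here eq ≤d
  ... | no  ≰d = map₂ (there eq (ℕ.≰⇒> ≰d)) (cut o)

  cut-unique : ∀ {x v e e′} → Cut x v e → Cut x v e′ → e ≡ e′
  cut-unique (at-sink _)   (at-sink _)     = refl
  cut-unique (at-sink eq)  (here eq′ _)    with () ← trans (sym eq) eq′
  cut-unique (at-sink eq)  (there eq′ _ _) with () ← trans (sym eq) eq′
  cut-unique (here eq _)   (at-sink eq′)   with () ← trans (sym eq) eq′
  cut-unique (here eq ≤d)  (here eq′ _)    with refl ← trans (sym eq) eq′ = refl
  cut-unique (here eq ≤d)  (there eq′ >d _) with refl ← trans (sym eq) eq′ = contradiction ≤d (ℕ.<⇒≱ >d)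
  cut-unique (there eq _ _) (at-sink eq′)  with () ← trans (sym eq) eq′
  cut-unique (there eq >d _) (here eq′ ≤d) with refl ← trans (sym eq) eq′ = contradiction ≤d (ℕ.<⇒≱ >d)
  cut-unique (there eq _ c) (there eq′ _ c′) with refl ← trans (sym eq) eq′ = cut-unique c c′

  cut-path : ∀ {x v u b} → Cut x v (u , b) → v ⟶* u
  cut-path (at-sink _)    = stay
  cut-path (here _ _)     = stay
  cut-path (there eq _ c) = (_ , _ , eq , _ , refl) ◅ cut-path c

  edge-◅-path : ∀ {u v w} → Edge node u v → v ⟶* w → TransClosure (Edge node) u w
  edge-◅-path e stay          = [ e ]
  edge-◅-path e (e′ ◅ path) = e ∷ edge-◅-path e′ path

  -- The nodes that x meets before u lie on a path from the source to u, so their queries belong to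
  -- `PreQuery u` and y answers them as x does. Whether an edge is a cut depends on its head and not
  -- on the input, so y crosses the same edges and stops at the same one.
  cut-transfer : ∀ {x y v u b} → source ⟶* v → (∀ {b} → node u ≢ sink b) →
                 (∀ {q} → PreQuery u q → eval q x ≡ eval q y) → (∀ {q} → HasQuery P u q → eval q x ≡ eval q y) →
                 Cut x v (u , b) → Cut y v (u , b)
  cut-transfer path inner-u agree agree-u (at-sink eq) = contradiction eq inner-u
  cut-transfer {x} {y} path inner-u agree agree-u (here {v} {q} {next} eq ≤d) =
    subst (λ b → Cut y v (v , b)) (sym b≡) (here eq (subst (λ b → dim (post (next b)) ℕ.≤ d) b≡ ≤d))
    where b≡ = agree-u (next , eq)
  cut-transfer {x} {y} {u = u} path inner-u agree agree-u (there {v} {q} {next} eq >d c) =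
    there eq (subst (λ b → d ℕ.< dim (post (next b))) b≡ >d)
      (subst (λ b → Cut y (next b) _) b≡ (cut-transfer (path ◅◅ (e ◅ stay)) inner-u agree agree-u c))
    where
    e : Edge node v (next (eval q x))
    e = q , next , eq , eval q x , refl
    b≡ : eval q x ≡ eval q y
    b≡ = agree (v , path , edge-◅-path e (cut-path c) , next , eq)

  outcome-after-cut : ∀ {x a v u b q next} → node u ≡ inner q next → Cut x v (u , b) →
                      Outcome P x a v → Outcome P x a (next b)
  outcome-after-cut eq (at-sink eq′) _           with () ← trans (sym eq) eq′
  outcome-after-cut eq (here eq′ _)  (stop eq″)  with () ← trans (sym eq) eq″
  outcome-after-cut eq (here eq′ _)  (step eq″ o)
    with refl ← trans (sym eq) eq′ | refl ← trans (sym eq) eq″ = o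
  outcome-after-cut eq (there eq′ _ c) (stop eq″)   with () ← trans (sym eq′) eq″
  outcome-after-cut eq (there eq′ _ c) (step eq″ o)
    with refl ← trans (sym eq′) eq″ = outcome-after-cut eq c o

  module _ {g : Cube (m ℕ.+ d) → Bool} (computes : Computes P g) where

    CutCoordinates : Fin size × Bool → Set
    CutCoordinates e = ∃[ φ ] ∃[ ψ ] Coordinates {m = m} {d} φ ψ ×
      (∀ {x y} → Cut x source e → evals φ x ≡ evals φ y → Cut y source e) ×
      (∀ {x y} → Cut x source e → Cut y source e → evals ψ x ≡ evals ψ y → g x ≡ g y)

    -- The space `Pre P v` also collects queries from paths that avoid u, and its dimension may
    -- exceed m. The forms φ are therefore built from a basis of `Pre P u` and the query at u: at
    -- most m forms, all inside `Pre P v` and hence independent of `Post P v`.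
    edge-coordinates : ∀ {u q next} → source ⟶* u → node u ≡ inner q next → dim (pre u) ℕ.< m →
                       ∀ b → dim (post (next b)) ℕ.≤ d → CutCoordinates (u , b)
    edge-coordinates {u} {q} {next} path eq <m b ≤d =
      let v = next b
          e : Edge node u v
          e = q , next , eq , b , refl
          Pre-u⊆Pre-v : ∀ {p} → Pre P u p → Pre P v p
          Pre-u⊆Pre-v = Span-mono λ { (w , to-w , w-to-u , query) → w , to-w , w-to-u ∷ʳ e , query }
          (r , vs , r≤ , vs-ind , vs∈Pre , old⊆vs , q∈vs) =
            adjoin (independent (pre u)) (All.map Pre-u⊆Pre-v (inside (pre u)))
                   (∈⇒Span (u , path , [ e ] , next , eq))
          (φ , ψ , coords , φ⇒vs , ψ⇒ws) =
            extend-to-coordinates {m = m} {d} (ℕ.≤-trans r≤ <m) ≤d vs (vectors (post v))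
              (disjoint⇒Independent₂ (Pre∩Post v) vs-ind (independent (post v)) vs∈Pre (inside (post v)))
      in φ , ψ , coords ,
         (λ {x} {y} c φ≡ → cut-transfer stay (λ sink-u → contradiction (trans (sym eq) sink-u) λ ())
           (λ pq → InSpan-eval (old⊆vs (spanning (pre u) (∈⇒Span pq))) (φ⇒vs φ≡))
           (λ { {q′} (next′ , eq′) → query-agree (trans (sym eq) eq′) (InSpan-eval q∈vs (φ⇒vs φ≡)) })
           c) ,
         (λ {x} {y} c c′ ψ≡ → outcome-agree P
           (λ path′ query → InSpan-eval (spanning (post v) (∈⇒Span (_ , path′ , query))) (ψ⇒ws ψ≡))
           (outcome-after-cut eq c (computes x)) (outcome-after-cut eq c′ (computes y)))
      where
      query-agree : ∀ {q q′ next next′ x y} → inner {m ℕ.+ d} {size} q next ≡ inner q′ next′ →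
                    eval q x ≡ eval q y → eval q′ x ≡ eval q′ y
      query-agree refl h = h

    -- The invariant `dim (pre v) < m` survives each step before the cut, because the head w of a
    -- passed edge has `dim (post w) > d`. The same inequality shows that w is not a sink.
    cut-coordinates : ∀ {x v e} → source ⟶* v → (∀ {b} → node v ≢ sink b) → dim (pre v) ℕ.< m →
                      Cut x v e → CutCoordinates e
    cut-coordinates path inner-v <m (at-sink eq) = contradiction eq inner-v
    cut-coordinates path inner-v <m (here eq ≤d) = edge-coordinates path eq <m _ ≤d
    cut-coordinates {x} path inner-v <m (there {q = q} {next} eq >d c) =
      cut-coordinates (path ◅◅ ((q , next , eq , _ , refl) ◅ stay))
        (λ sink-w → contradiction (subst (d ℕ.<_) (dim-trivial (Post-sink sink-w) (post w)) >d) λ ())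
        (ℕ.≰⇒> λ m≤ → ℕ.<⇒≱ (ℕ.+-mono-≤-< m≤ >d) (dim-pre+dim-post≤ w))
        c
      where w = next (eval q x)

    source-coordinates : ∀ {x e} → Cut x source e → CutCoordinates e
    source-coordinates {x} c with node source in eq
    -- The invariant starts here: Pre is trivial at the source, since no edge enters it, and m is
    -- positive.
    ... | inner _ _ = cut-coordinates stay (λ eq′ → contradiction (trans (sym eq) eq′) λ ())
                        (subst (ℕ._< m) (sym (dim-trivial Pre-source (pre source))) 0<m) c
    -- A program whose source is a sink computes a constant, and every input has the same cut, so
    -- arbitrary coordinates will do.
    ... | sink b =
      let (φ , ψ , coords , _) = extend-to-coordinates {m = m} {d} z≤n z≤n [] [] λ { [] [] _ → refl , refl }
      in φ , ψ , coords ,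
         (λ c _ → sink-cut c) ,
         (λ _ _ _ → trans (sink-value (computes _)) (sym (sink-value (computes _))))
      where
      sink-cut : ∀ {x y e} → Cut x source e → Cut y source e
      sink-cut (at-sink eq′)    = at-sink eq′
      sink-cut (here eq′ _)     with () ← trans (sym eq) eq′
      sink-cut (there eq′ _ _)  with () ← trans (sym eq) eq′
      sink-value : ∀ {x a} → Outcome P x a source → a ≡ b
      sink-value (stop eq′)   with refl ← trans (sym eq) eq′ = refl
      sink-value (step eq′ _) with () ← trans (sym eq) eq′

    partition : Partition {m} {d} g (Fin size × Bool)
    partition = record
      { part = λ x → proj₁ (cut (computes x))
      ; part-coordinates = λ x₀ →
          let (φ , ψ , coords , φ-part , ψ-value) = source-coordinates (part-cut x₀)
          in φ , ψ , coords ,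
             (λ {x} {y} eq φ≡ → cut-unique (part-cut y) (φ-part (subst (Cut x source) eq (part-cut x)) φ≡)) ,
             (λ {x} {y} eq eq′ → ψ-value (subst (Cut x source) eq (part-cut x))
                                         (subst (Cut y source) eq′ (part-cut y)))
      }
      where
      part-cut : ∀ x → Cut x source (proj₁ (cut (computes x)))
      part-cut x = proj₂ (cut (computes x))

-- There are finitely many nodes, so the double negations commute with the choice of a basis at each
-- of them.
¬¬partition : ∀ {m d g} (P : LBP (m ℕ.+ d)) → 0 ℕ.< m → StronglyReadOnce P → Computes P g →
              ¬ ¬ Partition {m} {d} g (Fin (LBP.size P) × Bool)
¬¬partition P 0<m readOnce computes ¬partition =
  Fin.sequence applicative (λ v → ¬¬basis (Pre P v)) λ pre →
  Fin.sequence applicative (λ v → ¬¬basis (Post P v)) λ post →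
  ¬partition (Cuts.partition P 0<m readOnce pre post computes)
  where applicative = RawMonad.rawApplicative ¬¬-Monad

private
  variable
    A B : Set

-- Finite sums

-- The same fold as in `bias`, whose numerator is thus definitionally such a sum.
∑ : List A → (A → ℤ) → ℤ
∑ xs F = List.foldr ℤ._+_ 0ℤ (List.map F xs)

𝟙 : Bool → ℤ
𝟙 b = if b then 1ℤ else 0ℤ

∑-cong : (xs : List A) {F G : A → ℤ} → (∀ x → F x ≡ G x) → ∑ xs F ≡ ∑ xs G
∑-cong xs F≗G = cong (List.foldr ℤ._+_ 0ℤ) (List.map-cong F≗G xs)

∑-mono : (xs : List A) {F G : A → ℤ} → (∀ x → F x ℤ.≤ G x) → ∑ xs F ℤ.≤ ∑ xs G
∑-mono []       F≤G = ℤ.≤-refl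
∑-mono (x ∷ xs) F≤G = ℤ.+-mono-≤ (F≤G x) (∑-mono xs F≤G)

∑-zero : (xs : List A) → ∑ xs (λ _ → 0ℤ) ≡ 0ℤ
∑-zero []       = refl
∑-zero (x ∷ xs) = trans (ℤ.+-identityˡ _) (∑-zero xs)

∑-nonNeg : (xs : List A) {F : A → ℤ} → (∀ x → 0ℤ ℤ.≤ F x) → 0ℤ ℤ.≤ ∑ xs F
∑-nonNeg xs 0≤F = subst (ℤ._≤ ∑ xs _) (∑-zero xs) (∑-mono xs 0≤F)

∑-+ : (xs : List A) (F G : A → ℤ) → ∑ xs (λ x → F x ℤ.+ G x) ≡ ∑ xs F ℤ.+ ∑ xs G
∑-+ []       F G = refl
∑-+ (x ∷ xs) F G rewrite ∑-+ xs F G = lemma (F x) (G x) (∑ xs F) (∑ xs G)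
  where
  lemma : ∀ p q s t → (p ℤ.+ q) ℤ.+ (s ℤ.+ t) ≡ (p ℤ.+ s) ℤ.+ (q ℤ.+ t)
  lemma = solve-∀

∑-*ˡ : (xs : List A) (c : ℤ) (F : A → ℤ) → ∑ xs (λ x → c ℤ.* F x) ≡ c ℤ.* ∑ xs F
∑-*ˡ []       c F = sym (ℤ.*-zeroʳ c)
∑-*ˡ (x ∷ xs) c F = trans (cong (λ t → c ℤ.* F x ℤ.+ t) (∑-*ˡ xs c F)) (sym (ℤ.*-distribˡ-+ c (F x) _))

∑-*ʳ : (xs : List A) (F : A → ℤ) (c : ℤ) → ∑ xs (λ x → F x ℤ.* c) ≡ ∑ xs F ℤ.* c
∑-*ʳ xs F c = trans (∑-cong xs λ x → ℤ.*-comm (F x) c) (trans (∑-*ˡ xs c F) (ℤ.*-comm c _))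

∑-const : (xs : List A) (c : ℤ) → ∑ xs (λ _ → c) ≡ + length xs ℤ.* c
∑-const []       c = sym (ℤ.*-zeroˡ c)
∑-const (x ∷ xs) c = trans (cong (λ t → c ℤ.+ t) (∑-const xs c)) (lemma c (+ length xs))
  where
  lemma : ∀ c l → c ℤ.+ l ℤ.* c ≡ (1ℤ ℤ.+ l) ℤ.* c
  lemma = solve-∀

∑-swap : (xs : List A) (ys : List B) (F : A → B → ℤ) →
         ∑ xs (λ x → ∑ ys (F x)) ≡ ∑ ys (λ y → ∑ xs (λ x → F x y))
∑-swap []       ys F = sym (∑-zero ys)
∑-swap (x ∷ xs) ys F = trans (cong (λ t → ∑ ys (F x) ℤ.+ t) (∑-swap xs ys F)) (sym (∑-+ ys (F x) _))

∑-++ : (xs ys : List A) (F : A → ℤ) → ∑ (xs List.++ ys) F ≡ ∑ xs F ℤ.+ ∑ ys F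
∑-++ []       ys F = sym (ℤ.+-identityˡ _)
∑-++ (x ∷ xs) ys F = trans (cong (λ t → F x ℤ.+ t) (∑-++ xs ys F)) (sym (ℤ.+-assoc (F x) _ _))

∑-map : (h : A → B) (xs : List A) (F : B → ℤ) → ∑ (List.map h xs) F ≡ ∑ xs (F ∘ h)
∑-map h xs F = cong (List.foldr ℤ._+_ 0ℤ) (sym (List.map-∘ xs))

∑-cartesianProduct : (xs : List A) (ys : List B) (F : A × B → ℤ) →
                     ∑ (cartesianProduct xs ys) F ≡ ∑ xs (λ x → ∑ ys (λ y → F (x , y)))
∑-cartesianProduct []       ys F = refl
∑-cartesianProduct (x ∷ xs) ys F = trans (∑-++ (List.map (x ,_) ys) _ F)
  (cong₂ ℤ._+_ (∑-map (x ,_) ys F) (∑-cartesianProduct xs ys F))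

∑-*-∑ : (xs : List A) (ys : List B) (F : A → ℤ) (G : B → ℤ) →
        ∑ xs F ℤ.* ∑ ys G ≡ ∑ xs (λ x → ∑ ys (λ y → F x ℤ.* G y))
∑-*-∑ xs ys F G = trans (sym (∑-*ʳ xs F (∑ ys G))) (∑-cong xs λ x → sym (∑-*ˡ ys (F x) G))

∑-filter : (S : A → Bool) (xs : List A) (F : A → ℤ) →
           ∑ (filterᵇ S xs) F ≡ ∑ xs (λ x → 𝟙 (S x) ℤ.* F x)
∑-filter S []       F = refl
∑-filter S (x ∷ xs) F with S x
... | true  = cong₂ ℤ._+_ (sym (ℤ.*-identityˡ (F x))) (∑-filter S xs F)
... | false = trans (∑-filter S xs F) (sym (ℤ.+-identityˡ _))

-- Enumerations of finite types and changes of summation variable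

record Enumerates (xs : List A) : Set where
  field
    unique   : Unique xs
    complete : ∀ x → x ∈ xs

open Enumerates

∑-sift : {xs : List A} → Enumerates xs → (S : A → Bool) (F : A → ℤ) (y : A) → S y ≡ true →
         (∀ x → S x ≡ true → x ≡ y) → ∑ xs (λ x → 𝟙 (S x) ℤ.* F x) ≡ F y
∑-sift enum S F y Sy only-y = present (unique enum) (complete enum y)
  where
  false-elsewhere : ∀ {x} → y ≢ x → S x ≡ false
  false-elsewhere {x} y≢x with S x in eq
  ... | true  = contradiction (sym (only-y x eq)) y≢x
  ... | false = refl
  absent : ∀ {xs} → ListAll.All (y ≢_) xs → ∑ xs (λ x → 𝟙 (S x) ℤ.* F x) ≡ 0ℤ
  absent []           = refl
  absent {x ∷ xs} (y≢x ∷ y∉) rewrite false-elsewhere y≢x = trans (ℤ.+-identityˡ _) (absent y∉)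
  present : ∀ {xs} → Unique xs → y ∈ xs → ∑ xs (λ x → 𝟙 (S x) ℤ.* F x) ≡ F y
  present (y∉ ∷ _)  (here refl) rewrite Sy | absent y∉ = trans (ℤ.+-identityʳ _) (ℤ.*-identityˡ (F y))
  present (x∉ ∷ uniq) (there y∈) rewrite false-elsewhere (λ y≡x → ListAll.lookup x∉ y∈ (sym y≡x)) =
    trans (ℤ.+-identityˡ _) (present uniq y∈)

does⇒ : {P : Set} (P? : Dec P) → does P? ≡ true → P
does⇒ (yes p) _ = p

-- As E is injective, the indicator of its image at x is the sum over y of the indicators of
-- `x ≡ E y`. Exchanging the sums leaves for each y a sum over x with the single term at `E y`.
∑-image : {xs : List A} {ys : List B} → DecidableEquality A → Enumerates xs → Enumerates ys →
          {E : B → A} → Injective _≡_ _≡_ E →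
          (S : A → Bool) → (∀ y → S (E y) ≡ true) → (∀ x → S x ≡ true → ∃[ y ] x ≡ E y) →
          (F : A → ℤ) → ∑ xs (λ x → 𝟙 (S x) ℤ.* F x) ≡ ∑ ys (F ∘ E)
∑-image {xs = xs} {ys} _≟_ xs-enum ys-enum {E} E-inj S S-E image F = begin
  ∑ xs (λ x → 𝟙 (S x) ℤ.* F x)                                  ≡⟨ ∑-cong xs preimages ⟩
  ∑ xs (λ x → ∑ ys (λ y → 𝟙 (does (x ≟ E y)) ℤ.* F x))          ≡⟨ ∑-swap xs ys _ ⟩
  ∑ ys (λ y → ∑ xs (λ x → 𝟙 (does (x ≟ E y)) ℤ.* F x))          ≡⟨ ∑-cong ys (λ y → ∑-sift xs-enum _ F (E y)
                                                                     (dec-true (E y ≟ E y) refl) (λ x → does⇒ (x ≟ E y))) ⟩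
  ∑ ys (F ∘ E)                                                  ∎
  where
  open ≡-Reasoning
  preimages : ∀ x → 𝟙 (S x) ℤ.* F x ≡ ∑ ys (λ y → 𝟙 (does (x ≟ E y)) ℤ.* F x)
  preimages x with S x in eq
  ... | true with image x eq
  ...   | y , refl = trans (ℤ.*-identityˡ _) (sym (∑-sift ys-enum _ _ y (dec-true (E y ≟ E y) refl)
                       (λ y′ eq′ → sym (E-inj (does⇒ (E y ≟ E y′) eq′)))))
  preimages x | false = sym (trans (∑-cong ys λ y → cong (λ b → 𝟙 b ℤ.* F x)
    (dec-false (x ≟ E y) λ { refl → contradiction (trans (sym eq) (S-E y)) λ () })) (∑-zero ys))

∑-bijection : {xs : List A} {ys : List B} → DecidableEquality A → Enumerates xs → Enumerates ys →
              {E : B → A} → Injective _≡_ _≡_ E → (∀ x → ∃[ y ] x ≡ E y) →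
              (F : A → ℤ) → ∑ xs F ≡ ∑ ys (F ∘ E)
∑-bijection {xs = xs} _≟_ xs-enum ys-enum inj surj F =
  trans (∑-cong xs λ x → sym (ℤ.*-identityˡ (F x)))
        (∑-image _≟_ xs-enum ys-enum inj (λ _ → true) (λ _ → refl) (λ x _ → surj x) F)

cartesianProduct-enumerates : {xs : List A} {ys : List B} → Enumerates xs → Enumerates ys →
                              Enumerates (cartesianProduct xs ys)
cartesianProduct-enumerates xs-enum ys-enum = record
  { unique   = Unique.cartesianProduct⁺ (unique xs-enum) (unique ys-enum)
  ; complete = λ (x , y) → List.∈-cartesianProduct⁺ (complete xs-enum x) (complete ys-enum y)
  }

allFin-enumerates : ∀ n → Enumerates (allFin n)
allFin-enumerates n = record { unique = Unique.allFin⁺ n ; complete = List.∈-allFin }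

allBools : List Bool
allBools = false ∷ true ∷ []

allBools-enumerates : Enumerates allBools
allBools-enumerates = record
  { unique   = ((λ ()) ∷ []) ∷ [] ∷ []
  ; complete = λ { false → here refl ; true → there (here refl) }
  }

allPoints-enumerates : ∀ n → Enumerates (allPoints n)
allPoints-enumerates zero    = record { unique = [] ∷ [] ; complete = λ { [] → here refl } }
allPoints-enumerates (suc n) = record
  { unique   = Unique.++⁺ (Unique.map⁺ Vec.∷-injectiveʳ (unique ih)) (Unique.map⁺ Vec.∷-injectiveʳ (unique ih))
      λ { (x∈₀ , x∈₁) → heads-differ (List.∈-map⁻ _ x∈₀) (List.∈-map⁻ _ x∈₁) }
  ; complete = λ { (false ∷ x) → List.∈-++⁺ˡ (List.∈-map⁺ _ (complete ih x))
                 ; (true ∷ x)  → List.∈-++⁺ʳ _ (List.∈-map⁺ _ (complete ih x)) }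
  }
  where
  ih = allPoints-enumerates n
  heads-differ : ∀ {x : Cube (suc n)} → ∃[ y ] (y ∈ allPoints n × x ≡ false ∷ y) →
                 ¬ (∃[ y ] (y ∈ allPoints n × x ≡ true ∷ y))
  heads-differ (_ , _ , refl) (_ , _ , ())

length-allPoints : ∀ n → length (allPoints n) ≡ 2 ℕ.^ n
length-allPoints zero    = refl
length-allPoints (suc n) = begin
  length (List.map (false ∷_) ps List.++ List.map (true ∷_) ps)            ≡⟨ List.length-++ (List.map (false ∷_) ps) ⟩
  length (List.map (false ∷_) ps) ℕ.+ length (List.map (true Vec.∷_) ps)   ≡⟨ cong₂ ℕ._+_ (List.length-map _ ps) (List.length-map _ ps) ⟩
  length ps ℕ.+ length ps                                                  ≡⟨ cong₂ ℕ._+_ (length-allPoints n) (trans (length-allPoints n) (sym (ℕ.+-identityʳ _))) ⟩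
  2 ℕ.^ n ℕ.+ (2 ℕ.^ n ℕ.+ 0)                                              ∎
  where
  open ≡-Reasoning
  ps = allPoints n

-- The Cauchy-Schwarz inequality

*-nonNeg : ∀ {i j} → 0ℤ ℤ.≤ i → 0ℤ ℤ.≤ j → 0ℤ ℤ.≤ i ℤ.* j
*-nonNeg {i} {j} 0≤i 0≤j = subst (ℤ._≤ i ℤ.* j) (ℤ.*-zeroʳ i) (ℤ.*-monoˡ-≤-nonNeg i {{ℤ.nonNegative 0≤i}} 0≤j)

*-mono-≤ : ∀ {i j k l} → 0ℤ ℤ.≤ j → 0ℤ ℤ.≤ k → i ℤ.≤ j → k ℤ.≤ l → i ℤ.* k ℤ.≤ j ℤ.* l
*-mono-≤ {i} {j} {k} {l} 0≤j 0≤k i≤j k≤l =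
  ℤ.≤-trans (ℤ.*-monoʳ-≤-nonNeg k {{ℤ.nonNegative 0≤k}} i≤j) (ℤ.*-monoˡ-≤-nonNeg j {{ℤ.nonNegative 0≤j}} k≤l)

i*i-nonNeg : ∀ i → 0ℤ ℤ.≤ i ℤ.* i
i*i-nonNeg (+ n)         = *-nonNeg {+ n} (ℤ.+≤+ z≤n) (ℤ.+≤+ z≤n)
i*i-nonNeg (ℤ.-[1+ n ])  = ℤ.+≤+ z≤n

square-cancel-≤ : ∀ {i j} → 0ℤ ℤ.≤ j → i ℤ.* i ℤ.≤ j ℤ.* j → i ℤ.≤ j
square-cancel-≤ {i} {j} 0≤j i²≤j² with i ℤ.≤? j
... | yes i≤j = i≤j
... | no  i≰j = contradiction i²≤j² (ℤ.<⇒≱ (ℤ.≤-<-trans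
  (ℤ.*-monoˡ-≤-nonNeg j {{ℤ.nonNegative 0≤j}} (ℤ.<⇒≤ j<i))
  (ℤ.*-monoʳ-<-pos i {{ℤ.positive (ℤ.≤-<-trans 0≤j j<i)}} j<i)))
  where j<i = ℤ.≰⇒> i≰j

-- The hypotheses bound the mixed term 2bSS′ by rt′ + r′t, by AM-GM.
+-cauchySchwarz : ∀ {b S r t S′ r′ t′} → 0ℤ ℤ.≤ b → 0ℤ ℤ.≤ r → 0ℤ ℤ.≤ t → 0ℤ ℤ.≤ r′ → 0ℤ ℤ.≤ t′ →
                  b ℤ.* (S ℤ.* S) ℤ.≤ r ℤ.* t → b ℤ.* (S′ ℤ.* S′) ℤ.≤ r′ ℤ.* t′ →
                  b ℤ.* ((S ℤ.+ S′) ℤ.* (S ℤ.+ S′)) ℤ.≤ (r ℤ.+ r′) ℤ.* (t ℤ.+ t′)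
+-cauchySchwarz {b} {S} {r} {t} {S′} {r′} {t′} 0≤b 0≤r 0≤t 0≤r′ 0≤t′ h h′ = begin
  b * ((S + S′) * (S + S′))                          ≡⟨ expand b S S′ ⟩
  b * (S * S) + b * (S′ * S′) + (+ 2) * (b * (S * S′))  ≤⟨ ℤ.+-mono-≤ (ℤ.+-mono-≤ h h′) mixed ⟩
  r * t + r′ * t′ + (r * t′ + r′ * t)                ≡⟨ collect r t r′ t′ ⟩
  (r + r′) * (t + t′)                                ∎
  where
  open ℤ.≤-Reasoning
  open import Data.Integer.Base using (_+_; _*_; _-_)
  expand : ∀ b S S′ → b * ((S + S′) * (S + S′)) ≡ b * (S * S) + b * (S′ * S′) + (+ 2) * (b * (S * S′))
  expand = solve-∀
  collect : ∀ r t r′ t′ → r * t + r′ * t′ + (r * t′ + r′ * t) ≡ (r + r′) * (t + t′)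
  collect = solve-∀
  square-mixed : ∀ b S S′ → ((+ 2) * (b * (S * S′))) * ((+ 2) * (b * (S * S′))) ≡
                            (+ 4) * ((b * (S * S)) * (b * (S′ * S′)))
  square-mixed = solve-∀
  amgm : ∀ r t r′ t′ → (+ 4) * ((r * t) * (r′ * t′)) + (r * t′ - r′ * t) * (r * t′ - r′ * t) ≡
                       (r * t′ + r′ * t) * (r * t′ + r′ * t)
  amgm = solve-∀
  mixed : (+ 2) * (b * (S * S′)) ℤ.≤ r * t′ + r′ * t
  mixed = square-cancel-≤ (ℤ.+-mono-≤ (*-nonNeg 0≤r 0≤t′) (*-nonNeg 0≤r′ 0≤t)) (begin
    ((+ 2) * (b * (S * S′))) * ((+ 2) * (b * (S * S′)))
      ≡⟨ square-mixed b S S′ ⟩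
    (+ 4) * ((b * (S * S)) * (b * (S′ * S′)))
      ≤⟨ ℤ.*-monoˡ-≤-nonNeg (+ 4) (*-mono-≤ (*-nonNeg 0≤r 0≤t) (*-nonNeg 0≤b (i*i-nonNeg S′)) h h′) ⟩
    (+ 4) * ((r * t) * (r′ * t′))
      ≡⟨ ℤ.+-identityʳ _ ⟨
    (+ 4) * ((r * t) * (r′ * t′)) + 0ℤ
      ≤⟨ ℤ.+-monoʳ-≤ ((+ 4) * ((r * t) * (r′ * t′))) (i*i-nonNeg (r * t′ - r′ * t)) ⟩
    (+ 4) * ((r * t) * (r′ * t′)) + (r * t′ - r′ * t) * (r * t′ - r′ * t)
      ≡⟨ amgm r t r′ t′ ⟩
    (r * t′ + r′ * t) * (r * t′ + r′ * t) ∎)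

-- Termwise bounds of the shape b·S² ≤ r·t add up without division or square roots. Both uses fit
-- this shape: the sum over ψ values with b = r = 1, and the sum over parts with r the mass of the
-- part.
∑-cauchySchwarz : (xs : List A) {b : ℤ} {S r t : A → ℤ} → 0ℤ ℤ.≤ b →
                  (∀ x → 0ℤ ℤ.≤ r x) → (∀ x → 0ℤ ℤ.≤ t x) →
                  (∀ x → b ℤ.* (S x ℤ.* S x) ℤ.≤ r x ℤ.* t x) →
                  b ℤ.* (∑ xs S ℤ.* ∑ xs S) ℤ.≤ ∑ xs r ℤ.* ∑ xs t
∑-cauchySchwarz []       {b} 0≤b 0≤r 0≤t h = ℤ.≤-reflexive (ℤ.*-zeroʳ b)
∑-cauchySchwarz (x ∷ xs) {S = S} {r} {t} 0≤b 0≤r 0≤t h =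
  +-cauchySchwarz {S = S x} {r x} {t x} {∑ xs S} 0≤b (0≤r x) (0≤t x) (∑-nonNeg xs 0≤r) (∑-nonNeg xs 0≤t)
    (h x) (∑-cauchySchwarz xs {S = S} {r} {t} 0≤b 0≤r 0≤t h)

-- Correlation with directional extractors

𝟙-nonNeg : ∀ b → 0ℤ ℤ.≤ 𝟙 b
𝟙-nonNeg false = ℤ.≤-refl
𝟙-nonNeg true  = ℤ.+≤+ z≤n

sign-* : ∀ p q r → sign (p xor r) ℤ.* sign (q xor r) ≡ sign (q xor p)
sign-* false false false = refl
sign-* false false true  = refl
sign-* false true  false = refl
sign-* false true  true  = refl
sign-* true  false false = refl
sign-* true  false true  = refl
sign-* true  true  false = refl
sign-* true  true  true  = refl

2^ : ℕ → ℤ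
2^ n = + (2 ℕ.^ n)

∑-points : ∀ n (c : ℤ) → ∑ (allPoints n) (λ _ → c) ≡ 2^ n ℤ.* c
∑-points n c = trans (∑-const (allPoints n) c) (cong (λ l → + l ℤ.* c) (length-allPoints n))

-- The extractor property with bias a / b, with denominators cleared.
DirectionalBound : ∀ {n} (d : ℕ) (a b : ℤ) (f : Cube n → Bool) → Set
DirectionalBound {n} d a b f = ∀ α → α ≢ 𝟎 → ∀ x (ks : Vec (Cube n) d) → LinearlyIndependent ks →
  b ℤ.* ∑ (allPoints d) (λ z → sign (D α f (x ⊕ lincomb z ks))) ℤ.≤ a ℤ.* 2^ d

module _ {m d : ℕ} {a b : ℤ} (0≤a : 0ℤ ℤ.≤ a) (0≤b : 0ℤ ℤ.≤ b)
         {f : Cube (m ℕ.+ d) → Bool} (extractor : DirectionalBound d a b f)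
         (g : Cube (m ℕ.+ d) → Bool) where
  open import Data.Integer.Base using (_+_; _*_)

  private
    ys = allPoints m
    zs = allPoints d

  mass : (Cube (m ℕ.+ d) → Bool) → ℤ
  mass R = ∑ (allPoints (m ℕ.+ d)) (λ x → 𝟙 (R x))

  correlation : (Cube (m ℕ.+ d) → Bool) → ℤ
  correlation R = ∑ (allPoints (m ℕ.+ d)) (λ x → 𝟙 (R x) * sign (f x xor g x))

  module _ {φ : Vec (Form (m ℕ.+ d)) m} {ψ : Vec (Form (m ℕ.+ d)) d} (coords : Coordinates φ ψ)
           {R : Cube (m ℕ.+ d) → Bool}
           (φ-R : ∀ {x y} → R x ≡ true → evals φ x ≡ evals φ y → R y ≡ true)
           (ψ-g : ∀ {x y} → R x ≡ true → R y ≡ true → evals ψ x ≡ evals ψ y → g x ≡ g y) where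
    open Coordinates coords

    private
      -- R is a union of fibres of φ, so testing one point of each fibre suffices and any value of ψ
      -- could stand for 𝟎.
      Y : Cube m → Bool
      Y y = R (point y 𝟎)

      R≡Y : ∀ y z → R (point y z) ≡ Y y
      R≡Y y z = Bool.⇔→≡ (mk⇔ (λ r → φ-R r (trans (φ-point y z) (sym (φ-point y 𝟎))))
                               (λ r → φ-R r (trans (φ-point y 𝟎) (sym (φ-point y z)))))

      |Y| : ℤ
      |Y| = ∑ ys (λ y → 𝟙 (Y y))

      agreement : Cube m → Cube d → ℤ
      agreement y z = sign (f (point y z) xor g (point y z))

      w : Cube m → Cube d → ℤ
      w y z = 𝟙 (Y y) * agreement y z

      ∑-coordinates : ∀ F → ∑ (allPoints (m ℕ.+ d)) F ≡ ∑ zs (λ z → ∑ ys (λ y → F (point y z)))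
      ∑-coordinates F = trans
        (∑-bijection _≟ᶜ_ (allPoints-enumerates (m ℕ.+ d))
           (cartesianProduct-enumerates (allPoints-enumerates d) (allPoints-enumerates m))
           {E = λ (z , y) → point y z}
           (λ eq → let (p , q) = point-injective eq in cong₂ _,_ q p)
           (λ x → (evals ψ x , evals φ x) , sym (point-φψ x)) F)
        (∑-cartesianProduct zs ys _)

      mass≡ : mass R ≡ 2^ d * |Y|
      mass≡ = trans (∑-coordinates _)
        (trans (∑-cong zs λ z → ∑-cong ys λ y → cong 𝟙 (R≡Y y z)) (∑-points d |Y|))

      correlation≡ : correlation R ≡ ∑ zs (λ z → ∑ ys (λ y → w y z))
      correlation≡ = trans (∑-coordinates _)
        (∑-cong zs λ z → ∑-cong ys λ y → cong (λ r → 𝟙 r * agreement y z) (R≡Y y z))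

      ks : Vec (Cube (m ℕ.+ d)) d
      ks = proj₁ fibre

      -- Here g cancels, as it depends on z only; what remains is the derivative of f
      -- in the direction point (y ⊕ y′) 𝟎.
      off-diagonal : ∀ {y y′} → y ≢ y′ → Y y ≡ true → Y y′ ≡ true →
        b * ∑ zs (λ z → agreement y z * agreement y′ z) ℤ.≤ a * 2^ d
      off-diagonal {y} {y′} y≢y′ Yy Yy′ = subst (λ t → b * t ℤ.≤ a * 2^ d) (∑-cong zs (sym ∘ product))
        (extractor α α≢𝟎 (point y 𝟎) ks (proj₁ (proj₂ fibre)))
        where
        α = point (y ⊕ y′) 𝟎
        α≢𝟎 : α ≢ 𝟎
        α≢𝟎 eq = y≢y′ (x⊕y≡𝟎⇒x≡y (proj₁ (point-injective (trans eq (sym point-𝟎)))))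
        shift : ∀ z → point y z ⊕ α ≡ point y′ z
        shift z = trans (point-⊕ y z (y ⊕ y′) 𝟎) (cong₂ point (⊕-cancel y y′) (⊕-identityʳ z))
        same-g : ∀ z → g (point y′ z) ≡ g (point y z)
        same-g z = ψ-g (trans (R≡Y y′ z) Yy′) (trans (R≡Y y z) Yy) (trans (ψ-point y′ z) (sym (ψ-point y z)))
        product : ∀ z → agreement y z * agreement y′ z ≡ sign (D α f (point y 𝟎 ⊕ lincomb z ks))
        product z rewrite sym (proj₂ (proj₂ fibre) y z) | shift z | same-g z =
          sign-* (f (point y z)) (f (point y′ z)) (g (point y z))

      -- On the diagonal all products are 1 and the sum is the full 2^d; off it the extractor
      -- applies. The diagonal also receives the nonnegative extractor term, so that this term
      -- becomes a plain product when summed over all pairs.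
      pair-bound : ∀ y y′ → b * ∑ zs (λ z → w y z * w y′ z) ℤ.≤
                            𝟙 (Y y) * (𝟙 (does (y′ ≟ᶜ y)) * (b * 2^ d) + 𝟙 (Y y′) * (a * 2^ d))
      pair-bound y y′ with Y y in Yy | Y y′ in Yy′
      ... | false | _     = ℤ.≤-reflexive (trans (cong (b *_) (∑-zero zs)) (ℤ.*-zeroʳ b))
      ... | true  | false = ℤ.≤-trans
        (ℤ.≤-reflexive (trans
          (cong (b *_) (trans (∑-cong zs λ z → ℤ.*-zeroʳ (1ℤ * agreement y z)) (∑-zero zs)))
          (ℤ.*-zeroʳ b)))
        (*-nonNeg {1ℤ} (ℤ.+≤+ z≤n) (ℤ.+-mono-≤
          (*-nonNeg (𝟙-nonNeg (does (y′ ≟ᶜ y))) (*-nonNeg 0≤b (ℤ.+≤+ z≤n))) ℤ.≤-refl))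
      ... | true  | true  with y′ ≟ᶜ y
      ...   | yes refl = begin
        b * ∑ zs (λ z → 1ℤ * agreement y z * (1ℤ * agreement y z))
          ≡⟨ cong (b *_) (trans (∑-cong zs λ z → unit (f (point y z) xor g (point y z))) (∑-points d 1ℤ)) ⟩
        b * (2^ d * 1ℤ)                                ≡⟨ pad b (2^ d) ⟩
        1ℤ * (1ℤ * (b * 2^ d) + 0ℤ)
          ≤⟨ ℤ.*-monoˡ-≤-nonNeg 1ℤ (ℤ.+-monoʳ-≤ (1ℤ * (b * 2^ d))
               (*-nonNeg {1ℤ} (ℤ.+≤+ z≤n) (*-nonNeg 0≤a (ℤ.+≤+ z≤n)))) ⟩
        1ℤ * (1ℤ * (b * 2^ d) + 1ℤ * (a * 2^ d))       ∎
        where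
        open ℤ.≤-Reasoning
        unit : ∀ c → 1ℤ * sign c * (1ℤ * sign c) ≡ 1ℤ
        unit false = refl
        unit true  = refl
        pad : ∀ b t → b * (t * 1ℤ) ≡ 1ℤ * (1ℤ * (b * t) + 0ℤ)
        pad = solve-∀
      ...   | no y′≢y = begin
        b * ∑ zs (λ z → 1ℤ * agreement y z * (1ℤ * agreement y′ z))
          ≡⟨ cong (b *_) (∑-cong zs λ z →
               cong₂ _*_ (ℤ.*-identityˡ (agreement y z)) (ℤ.*-identityˡ (agreement y′ z))) ⟩
        b * ∑ zs (λ z → agreement y z * agreement y′ z)
          ≤⟨ off-diagonal (y′≢y ∘ sym) Yy Yy′ ⟩
        a * 2^ d                                       ≡⟨ pad (a * 2^ d) ⟩
        1ℤ * (0ℤ + 1ℤ * (a * 2^ d))                    ∎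
        where
        open ℤ.≤-Reasoning
        pad : ∀ t → t ≡ 1ℤ * (0ℤ + 1ℤ * t)
        pad = solve-∀

    -- With the sum over z outermost, squaring multiplies only terms with a common z, which is where
    -- the values of g agree. The |Y| diagonal pairs bring b·2^d each and all |Y|² pairs bring
    -- a·2^d, while 2^d·|Y| is the mass of R.
    part-correlation : b * (correlation R * correlation R) ℤ.≤ mass R * (b * 2^ d + a * mass R)
    part-correlation = begin
      b * (correlation R * correlation R)
        ≡⟨ cong (λ S → b * (S * S)) correlation≡ ⟩
      b * (∑ zs column * ∑ zs column)
        ≤⟨ ℤ.*-monoˡ-≤-nonNeg b {{ℤ.nonNegative 0≤b}} cauchySchwarz ⟩
      b * (2^ d * ∑ zs (λ z → column z * column z))
        ≡⟨ cong (λ s → b * (2^ d * s)) (trans (∑-cong zs λ z → ∑-*-∑ ys ys (λ y → w y z) (λ y → w y z)) reorder) ⟩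
      b * (2^ d * ∑ ys (λ y → ∑ ys (λ y′ → ∑ zs (λ z → w y z * w y′ z))))
        ≡⟨ swap-factors b (2^ d) _ ⟩
      2^ d * (b * ∑ ys (λ y → ∑ ys (λ y′ → ∑ zs (λ z → w y z * w y′ z))))
        ≡⟨ cong (2^ d *_) (trans (sym (∑-*ˡ ys b _)) (∑-cong ys λ y → sym (∑-*ˡ ys b _))) ⟩
      2^ d * ∑ ys (λ y → ∑ ys (λ y′ → b * ∑ zs (λ z → w y z * w y′ z)))
        ≤⟨ ℤ.*-monoˡ-≤-nonNeg (2^ d) (∑-mono ys λ y → ∑-mono ys λ y′ → pair-bound y y′) ⟩
      2^ d * ∑ ys (λ y → ∑ ys (λ y′ → 𝟙 (Y y) * (𝟙 (does (y′ ≟ᶜ y)) * (b * 2^ d) + 𝟙 (Y y′) * (a * 2^ d))))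
        ≡⟨ cong (2^ d *_) (trans (∑-cong ys row) (∑-*ʳ ys _ _)) ⟩
      2^ d * (|Y| * (b * 2^ d + |Y| * (a * 2^ d)))
        ≡⟨ collect (2^ d) |Y| a b ⟩
      2^ d * |Y| * (b * 2^ d + a * (2^ d * |Y|))
        ≡⟨ cong (λ r → r * (b * 2^ d + a * r)) mass≡ ⟨
      mass R * (b * 2^ d + a * mass R) ∎
      where
      open ℤ.≤-Reasoning
      column : Cube d → ℤ
      column z = ∑ ys (λ y → w y z)
      cauchySchwarz : ∑ zs column * ∑ zs column ℤ.≤ 2^ d * ∑ zs (λ z → column z * column z)
      cauchySchwarz = begin
        ∑ zs column * ∑ zs column            ≡⟨ ℤ.*-identityˡ _ ⟨
        1ℤ * (∑ zs column * ∑ zs column)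
          ≤⟨ ∑-cauchySchwarz zs {1ℤ} {column} {λ _ → 1ℤ} (ℤ.+≤+ z≤n) (λ _ → ℤ.+≤+ z≤n)
               (λ z → i*i-nonNeg (column z)) (λ _ → ℤ.≤-refl) ⟩
        ∑ zs (λ _ → 1ℤ) * ∑ zs (λ z → column z * column z)
          ≡⟨ cong (_* ∑ zs (λ z → column z * column z)) (trans (∑-points d 1ℤ) (ℤ.*-identityʳ (2^ d))) ⟩
        2^ d * ∑ zs (λ z → column z * column z) ∎
      reorder : ∑ zs (λ z → ∑ ys (λ y → ∑ ys (λ y′ → w y z * w y′ z))) ≡
                ∑ ys (λ y → ∑ ys (λ y′ → ∑ zs (λ z → w y z * w y′ z)))
      reorder = trans (∑-swap zs ys _) (∑-cong ys λ y → ∑-swap zs ys _)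
      swap-factors : ∀ p q s → p * (q * s) ≡ q * (p * s)
      swap-factors = solve-∀
      collect : ∀ t y a b → t * (y * (b * t + y * (a * t))) ≡ t * y * (b * t + a * (t * y))
      collect = solve-∀
      row : ∀ y → ∑ ys (λ y′ → 𝟙 (Y y) * (𝟙 (does (y′ ≟ᶜ y)) * (b * 2^ d) + 𝟙 (Y y′) * (a * 2^ d))) ≡
                  𝟙 (Y y) * (b * 2^ d + |Y| * (a * 2^ d))
      row y = trans (∑-*ˡ ys (𝟙 (Y y)) _) (cong (𝟙 (Y y) *_) (trans (∑-+ ys _ _) (cong₂ _+_
        (∑-sift (allPoints-enumerates m) (λ y′ → does (y′ ≟ᶜ y)) (λ _ → b * 2^ d) y
                (dec-true (y ≟ᶜ y) refl) (λ y′ → does⇒ (y′ ≟ᶜ y)))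
        (∑-*ʳ ys _ _))))

  total : ℤ
  total = ∑ (allPoints (m ℕ.+ d)) (λ x → sign (f x xor g x))

  -- With the masses as weights both factors of the Cauchy-Schwarz bound can be summed exactly,
  -- since the masses add up to 2^n. The number of parts enters only through the diagonal term
  -- b·2^d.
  partition-correlation : ∀ {I} {es : List I} → DecidableEquality I → Enumerates es → Partition {m} {d} g I →
                          b * (total * total) ℤ.≤ 2^ (m ℕ.+ d) * (+ length es * (b * 2^ d) + a * 2^ (m ℕ.+ d))
  partition-correlation {I} {es} _≟_ es-enum p = begin
    b * (total * total)
      ≡⟨ cong (λ T → b * (T * T)) total≡ ⟩
    b * (∑ es (correlation ∘ R) * ∑ es (correlation ∘ R))
      ≤⟨ ∑-cauchySchwarz es {S = correlation ∘ R} 0≤b mass-nonNeg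
           (λ e → ℤ.+-mono-≤ (*-nonNeg 0≤b (ℤ.+≤+ z≤n)) (*-nonNeg 0≤a (mass-nonNeg e))) bound ⟩
    ∑ es (mass ∘ R) * ∑ es (λ e → b * 2^ d + a * mass (R e))
      ≡⟨ cong₂ _*_ mass-total (trans (∑-+ es _ _) (cong₂ _+_ (∑-const es (b * 2^ d))
           (trans (∑-*ˡ es a (mass ∘ R)) (cong (a *_) mass-total)))) ⟩
    2^ (m ℕ.+ d) * (+ length es * (b * 2^ d) + a * 2^ (m ℕ.+ d)) ∎
    where
    open ℤ.≤-Reasoning
    open Partition p
    xs = allPoints (m ℕ.+ d)
    R : I → Cube (m ℕ.+ d) → Bool
    R e x = does (part x ≟ e)
    mass-nonNeg : ∀ e → 0ℤ ℤ.≤ mass (R e)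
    mass-nonNeg e = ∑-nonNeg xs λ x → 𝟙-nonNeg (R e x)
    ∑-parts : ∀ F → ∑ xs F ≡ ∑ es (λ e → ∑ xs (λ x → 𝟙 (R e x) * F x))
    ∑-parts F = trans
      (∑-cong xs λ x → sym (∑-sift es-enum (λ e → R e x) (λ _ → F x) (part x)
        (dec-true (part x ≟ part x) refl) (λ e eq → sym (does⇒ (part x ≟ e) eq))))
      (∑-swap xs es _)
    total≡ : total ≡ ∑ es (correlation ∘ R)
    total≡ = ∑-parts _
    mass-total : ∑ es (mass ∘ R) ≡ 2^ (m ℕ.+ d)
    mass-total = trans (∑-cong es λ e → ∑-cong xs λ x → sym (ℤ.*-identityʳ (𝟙 (R e x))))
      (trans (sym (∑-parts (λ _ → 1ℤ))) (trans (∑-points (m ℕ.+ d) 1ℤ) (ℤ.*-identityʳ _)))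
    bound : ∀ e → b * (correlation (R e) * correlation (R e)) ℤ.≤ mass (R e) * (b * 2^ d + a * mass (R e))
    bound e with any-cube? (λ x → part x ≟ e)
    ... | yes (x₀ , refl) =
      let (φ , ψ , coords , φ-part , ψ-g) = part-coordinates x₀
      in part-correlation coords {R e}
           (λ {x} {y} x∈ φ≡ → dec-true (part y ≟ e) (φ-part (does⇒ (part x ≟ e) x∈) φ≡))
           (λ {x} {y} x∈ y∈ → ψ-g (does⇒ (part x ≟ e) x∈) (does⇒ (part y ≟ e) y∈))
    -- An empty part comes without coordinates, but its mass and its correlation are both 0.
    ... | no  empty = ℤ.≤-reflexive (trans
      (trans (cong (λ c → b * (c * c)) (vanish λ x → sign (f x xor g x))) (ℤ.*-zeroʳ b))
      (sym (cong (λ c → c * (b * 2^ d + a * c))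
        (trans (∑-cong xs λ x → sym (ℤ.*-identityʳ (𝟙 (R e x)))) (vanish λ _ → 1ℤ)))))
      where
      vanish : ∀ F → ∑ xs (λ x → 𝟙 (R e x) * F x) ≡ 0ℤ
      vanish F = trans (∑-cong xs λ x → cong (λ c → 𝟙 c * F x) (dec-false (part x ≟ e) λ eq → empty (x , eq)))
                       (∑-zero xs)

-- Rational and real bounds

fromℤ-* : ∀ i j → fromℤ (i ℤ.* j) ≡ fromℤ i ℚ.* fromℤ j
fromℤ-* i j = ℚ.toℚᵘ-injective (ℚᵘ.≃-sym (ℚ.toℚᵘ-homo-* (fromℤ i) (fromℤ j)))

fromℤ-+ : ∀ i j → fromℤ (i ℤ.+ j) ≡ fromℤ i ℚ.+ fromℤ j
fromℤ-+ i j = ℚ.toℚᵘ-injective (ℚᵘ.≃-trans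
  (ℚᵘ.≃-reflexive (cong₂ (λ s t → mkℚᵘ (s ℤ.+ t) 0) (sym (ℤ.*-identityʳ i)) (sym (ℤ.*-identityʳ j))))
  (ℚᵘ.≃-sym (ℚ.toℚᵘ-homo-+ (fromℤ i) (fromℤ j))))

fromℤ-mono-≤ : ∀ {i j} → i ℤ.≤ j → fromℤ i ℚ.≤ fromℤ j
fromℤ-mono-≤ {i} {j} i≤j = ℚ.*≤* (subst₂ ℤ._≤_ (sym (ℤ.*-identityʳ i)) (sym (ℤ.*-identityʳ j)) i≤j)

fromℤ-cancel-≤ : ∀ {i j} → fromℤ i ℚ.≤ fromℤ j → i ℤ.≤ j
fromℤ-cancel-≤ {i} {j} (ℚ.*≤* i≤j) = subst₂ ℤ._≤_ (ℤ.*-identityʳ i) (ℤ.*-identityʳ j) i≤j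

/-*-cancel : ∀ i k .{{_ : ℕ.NonZero k}} → (i / k) ℚ.* fromℤ (+ k) ≡ fromℤ i
/-*-cancel i (suc k) = ℚ.toℚᵘ-injective (ℚᵘ.≃-trans (ℚ.toℚᵘ-homo-* (i / suc k) (fromℤ (+ suc k)))
  (ℚᵘ.≃-trans (ℚᵘ.*-congʳ (ℚ.toℚᵘ-fromℚᵘ (mkℚᵘ i k)))
              (*≡* (trans (ℤ.*-identityʳ _) (cong (λ l → i ℤ.* + l) (sym (ℕ.*-identityʳ (suc k))))))))

/1 : ∀ i → i / 1 ≡ fromℤ i
/1 i = trans (sym (ℚ.*-identityʳ (i / 1))) (/-*-cancel i 1)

*-↧ : ∀ e → e ℚ.* fromℤ (↧ e) ≡ fromℤ (↥ e)
*-↧ e = trans (cong (ℚ._* fromℤ (↧ e)) (sym (ℚ.↥p/↧p≡p e))) (/-*-cancel (↥ e) (↧ₙ e))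

p≤∣p∣ : ∀ p → p ℚ.≤ ℚ.∣ p ∣
p≤∣p∣ p with ℚ.≤-total 0ℚ p
... | inj₁ 0≤p = ℚ.≤-reflexive (sym (ℚ.0≤p⇒∣p∣≡p 0≤p))
... | inj₂ p≤0 = ℚ.≤-trans p≤0 (ℚ.0≤∣p∣ p)

clear-denominator : ∀ e {i j} → fromℤ i ℚ.≤ e ℚ.* fromℤ j → ↧ e ℤ.* i ℤ.≤ ↥ e ℤ.* j
clear-denominator e {i} {j} h = fromℤ-cancel-≤ (begin
  fromℤ (↧ e ℤ.* i)                  ≡⟨ fromℤ-* (↧ e) i ⟩
  fromℤ (↧ e) ℚ.* fromℤ i            ≤⟨ ℚ.*-monoˡ-≤-nonNeg (fromℤ (↧ e)) {{ℚ.nonNegative (fromℤ-mono-≤ {0ℤ} (ℤ.+≤+ z≤n))}} h ⟩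
  fromℤ (↧ e) ℚ.* (e ℚ.* fromℤ j)    ≡⟨ rearrange (fromℤ (↧ e)) e (fromℤ j) ⟩
  e ℚ.* fromℤ (↧ e) ℚ.* fromℤ j      ≡⟨ cong (ℚ._* fromℤ j) (*-↧ e) ⟩
  fromℤ (↥ e) ℚ.* fromℤ j            ≡⟨ fromℤ-* (↥ e) j ⟨
  fromℤ (↥ e ℤ.* j)                  ∎)
  where
  open ℚ.≤-Reasoning
  rearrange : ∀ x y z → x ℚ.* (y ℚ.* z) ≡ y ℚ.* x ℚ.* z
  rearrange = solve 3 (λ x y z → x :* (y :* z) := y :* x :* z) refl
    where open +-*-Solver

-- The passage from real hypotheses to rational inequalities: a q below p would lie in both cuts of
-- x.
fromℚ≤ᴿ⇒≤ : ∀ {p q x} → fromℚ p ≤ᴿ x → ℝ.U x q → p ℚ.≤ q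
fromℚ≤ᴿ⇒≤ {x = x} p≤x x<q = ℚ.≮⇒≥ λ q<p → ℝ.disjoint x (p≤x _ q<p) x<q

-- The extractor hypothesis as an integer inequality on cosets

card-length : ∀ {n} (S : Cube n → Bool) → + card S ≡ ∑ (allPoints n) (λ x → 𝟙 (S x))
card-length {n} S = begin
  + length (elements S)                  ≡⟨ ℤ.*-identityʳ _ ⟨
  + length (elements S) ℤ.* 1ℤ           ≡⟨ ∑-const (elements S) 1ℤ ⟨
  ∑ (elements S) (λ _ → 1ℤ)              ≡⟨ ∑-filter S (allPoints n) (λ _ → 1ℤ) ⟩
  ∑ (allPoints n) (λ x → 𝟙 (S x) ℤ.* 1ℤ) ≡⟨ ∑-cong (allPoints n) (λ x → ℤ.*-identityʳ (𝟙 (S x))) ⟩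
  ∑ (allPoints n) (λ x → 𝟙 (S x))        ∎
  where open ≡-Reasoning

module _ {n d : ℕ} (x₀ : Cube n) (ks : Vec (Cube n) d) (ind : LinearlyIndependent ks) where
  private
    E : Cube d → Cube n
    E z = x₀ ⊕ lincomb z ks

    E-injective : ∀ {z z′} → E z ≡ E z′ → z ≡ z′
    E-injective {z} {z′} eq = lincomb-injective ind
      (trans (sym (⊕-cancel x₀ _)) (trans (cong (x₀ ⊕_) eq) (⊕-cancel x₀ _)))

    inCoset? : ∀ x → Dec (∃[ z ] x ≡ E z)
    inCoset? x = any-cube? λ z → x ≟ᶜ E z

  coset : Cube n → Bool
  coset x = does (inCoset? x)

  coset-isAffine : IsAffineSubspace d coset
  coset-isAffine = x₀ , ks , ind , λ x → mk⇔ (does⇒ (inCoset? x)) (dec-true (inCoset? x))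

  ∑-coset : ∀ F → ∑ (elements coset) F ≡ ∑ (allPoints d) (F ∘ E)
  ∑-coset F = trans (∑-filter coset (allPoints n) F)
    (∑-image _≟ᶜ_ (allPoints-enumerates n) (allPoints-enumerates d) E-injective coset
       (λ z → dec-true (inCoset? (E z)) (z , refl)) (λ x → does⇒ (inCoset? x)) F)

  card-coset : card coset ≡ 2 ℕ.^ d
  card-coset = ℤ.+-injective (begin
    + card coset                   ≡⟨ ℤ.*-identityʳ _ ⟨
    + card coset ℤ.* 1ℤ            ≡⟨ ∑-const (elements coset) 1ℤ ⟨
    ∑ (elements coset) (λ _ → 1ℤ)  ≡⟨ ∑-coset (λ _ → 1ℤ) ⟩
    ∑ (allPoints d) (λ _ → 1ℤ)     ≡⟨ ∑-points d 1ℤ ⟩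
    2^ d ℤ.* 1ℤ                    ≡⟨ ℤ.*-identityʳ _ ⟩
    2^ d                           ∎)
    where open ≡-Reasoning

directionalBound : ∀ {n d ε} {f : Cube n → Bool} {e} → DirectionalAffineExtractor d ε f → ℝ.U ε e →
                   DirectionalBound d (↥ e) (↧ e) f
directionalBound {n} {d} {ε} {f} {e} extractor ε<e α α≢𝟎 x ks ind =
  subst₂ (λ s t → ↧ e ℤ.* s ℤ.≤ ↥ e ℤ.* + t) (∑-coset x ks ind (sign ∘ D α f)) (card-coset x ks ind)
    (clear-denominator e (begin
      fromℤ numerator                          ≡⟨ /-*-cancel numerator (card S) ⟨
      (numerator / card S) ℚ.* fromℤ (+ card S)
        ≤⟨ ℚ.*-monoʳ-≤-nonNeg (fromℤ (+ card S)) {{ℚ.nonNegative (fromℤ-mono-≤ {0ℤ} (ℤ.+≤+ z≤n))}}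
             (ℚ.≤-trans (p≤∣p∣ _) (fromℚ≤ᴿ⇒≤ {x = ε} (extractor α α≢𝟎 S (coset-isAffine x ks ind)) ε<e)) ⟩
      e ℚ.* fromℤ (+ card S)                   ∎))
  where
  open ℚ.≤-Reasoning
  S = coset x ks ind
  instance
    card≢0 : ℕ.NonZero (card S)
    card≢0 = subst ℕ.NonZero (sym (card-coset x ks ind)) (ℕ.m^n≢0 2 d)
  numerator = ∑ (elements S) (sign ∘ D α f)

-- Consequences of the size hypothesis

size-bound : ∀ {ε e s k} → fromℚ (+ s / 1) ≤ᴿ ε *2^ k → ℝ.U ε e → + s / 1 ℚ.≤ e ℚ.* 2^ℤ k
size-bound {ε} {e} {s} {k} h ε<e = fromℚ≤ᴿ⇒≤ {x = ε *2^ k} h (subst (ℝ.U ε) (sym cancel) ε<e)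
  where
  instance
    2^k-pos = 2^ℤ-positive k
    2^k≢0 = ℚ.pos⇒nonZero (2^ℤ k)
  -- The upper cut of `ε *2^ k` at a rational is that of ε at the rational divided by 2^k.
  cancel : 1/ 2^ℤ k ℚ.* (e ℚ.* 2^ℤ k) ≡ e
  cancel = trans (cong (1/ 2^ℤ k ℚ.*_) (ℚ.*-comm e (2^ℤ k)))
    (trans (sym (ℚ.*-assoc (1/ 2^ℤ k) (2^ℤ k) e))
      (trans (cong (ℚ._* e) (ℚ.*-inverseˡ (2^ℤ k))) (ℚ.*-identityˡ e)))

2^ℤ-neg-≤1 : ∀ k → 2^ℤ -[1+ k ] ℚ.≤ 1ℚ
2^ℤ-neg-≤1 k = ℚ.*-cancelʳ-≤-pos (fromℤ (+ N)) {{N-pos}} (begin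
  2^ℤ -[1+ k ] ℚ.* fromℤ (+ N)  ≡⟨ /-*-cancel (+ 1) N ⟩
  fromℤ (+ 1)                   ≤⟨ fromℤ-mono-≤ (ℤ.+≤+ (ℕ.m^n>0 2 (suc k))) ⟩
  fromℤ (+ N)                   ≡⟨ ℚ.*-identityˡ _ ⟨
  1ℚ ℚ.* fromℤ (+ N)            ∎)
  where
  open ℚ.≤-Reasoning
  N = 2 ℕ.^ suc k
  instance N≢0 = ℕ.m^n≢0 2 (suc k)
  N-pos = ℚ.positive (ℚ.<-≤-trans (ℚ.positive⁻¹ 1ℚ) (fromℤ-mono-≤ (ℤ.+≤+ (ℕ.m^n>0 2 (suc k)))))

exponent-neg : ∀ n k → + n - + (n ℕ.+ k) - + 1 ≡ -[1+ k ]
exponent-neg n k = trans (cong (λ t → + n - t - + 1) (ℤ.pos-+ n k)) (lemma (+ n) (+ k))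
  where
  lemma : ∀ n k → n - (n ℤ.+ k) - + 1 ≡ ℤ.- (+ 1 ℤ.+ k)
  lemma = solve-∀

exponent-pos : ∀ m d → + (suc m ℕ.+ d) - + d - + 1 ≡ + m
exponent-pos m d = trans (cong (λ t → t - + d - + 1) (ℤ.pos-+ (suc m) d)) (lemma (+ m) (+ d))
  where
  lemma : ∀ m d → + 1 ℤ.+ m ℤ.+ d - d - + 1 ≡ m
  lemma = solve-∀

-- For n ≤ d the exponent n - d - 1 is negative and the size would be less than 1, whereas a program
-- has at least its source; hence the size `suc s`.
dimension-bound : ∀ {n d s ε} → ε <ᴿ fromℚ ½ → fromℚ (+ suc s / 1) ≤ᴿ ε *2^ (+ n - + d - + 1) → d ℕ.< n
dimension-bound {n} {d} {s} {ε} (e , ε<e , e<½) size≤ with d ℕ.<? n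
... | yes d<n = d<n
... | no  d≮n with ℕ.m≤n⇒∃[o]m+o≡n (ℕ.≮⇒≥ d≮n)
...   | k , refl = contradiction (begin-strict
  1ℚ                     ≤⟨ fromℤ-mono-≤ (ℤ.+≤+ (s≤s z≤n)) ⟩
  fromℤ (+ suc s)        ≡⟨ /1 (+ suc s) ⟨
  + suc s / 1            ≤⟨ size-bound {ε} {e} {suc s} { -[1+ k ]} (subst (λ j → fromℚ (+ suc s / 1) ≤ᴿ ε *2^ j) (exponent-neg n k) size≤) ε<e ⟩
  e ℚ.* p                <⟨ ℚ.*-monoˡ-<-pos p {{2^ℤ-positive -[1+ k ]}} (ℚ.<-trans {e} {½} {1ℚ} e<½ (ℚ.*<* (ℤ.+<+ (s≤s (s≤s z≤n))))) ⟩
  1ℚ ℚ.* p               ≡⟨ ℚ.*-identityˡ p ⟩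
  p                      ≤⟨ 2^ℤ-neg-≤1 k ⟩
  1ℚ                     ∎) (ℚ.<-irrefl refl)
  where
  open ℚ.≤-Reasoning
  p = 2^ℤ -[1+ k ]

integral-size-bound : ∀ {m d s ε e} → fromℚ (+ s / 1) ≤ᴿ ε *2^ (+ (suc m ℕ.+ d) - + d - + 1) → ℝ.U ε e →
                      ↧ e ℤ.* + s ℤ.≤ ↥ e ℤ.* 2^ m
integral-size-bound {m} {d} {s} {ε} {e} size≤ ε<e = clear-denominator e
  (subst₂ (λ p q → p ℚ.≤ e ℚ.* q) (/1 (+ s)) (/1 (2^ m))
    (size-bound {ε} {e} {s} {+ m} (subst (λ j → fromℚ (+ s / 1) ≤ᴿ ε *2^ j) (exponent-pos m d) size≤) ε<e))

length-edges : ∀ s → + length (cartesianProduct (allFin s) allBools) ≡ + s ℤ.* + 2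
length-edges s = begin
  + length edges                                     ≡⟨ ℤ.*-identityʳ _ ⟨
  + length edges ℤ.* 1ℤ                              ≡⟨ ∑-const edges 1ℤ ⟨
  ∑ edges (λ _ → 1ℤ)                                 ≡⟨ ∑-cartesianProduct (allFin s) allBools (λ _ → 1ℤ) ⟩
  ∑ (allFin s) (λ _ → + 2)                           ≡⟨ ∑-const (allFin s) (+ 2) ⟩
  + length (allFin s) ℤ.* + 2                        ≡⟨ cong (λ l → + l ℤ.* + 2) (List.length-tabulate {n = s} _) ⟩
  + s ℤ.* + 2                                        ∎
  where
  open ≡-Reasoning
  edges = cartesianProduct (allFin s) allBools

-- Two edge labels per node give 2s parts, and N = 2·2^m·2^d. The size bound thus turns the diagonal
-- term 2s·b·2^d into at most a·N, which doubles the extractor term.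
total-correlation : ∀ {m d a b s f} {g : Cube (suc m ℕ.+ d) → Bool} → 0ℤ ℤ.≤ b → DirectionalBound d a b f →
  b ℤ.* + s ℤ.≤ a ℤ.* 2^ m → Partition {suc m} {d} g (Fin s × Bool) →
  let N = 2^ (suc m ℕ.+ d) ; T = ∑ (allPoints (suc m ℕ.+ d)) (λ x → sign (f x xor g x)) in
  b ℤ.* (T ℤ.* T) ℤ.≤ N ℤ.* (+ 2 ℤ.* a ℤ.* N)
total-correlation {m} {d} {a} {b} {s} {f} {g} 0≤b extractor size≤ p = begin
  b * (T * T)                                      ≤⟨ partition-correlation {suc m} {d} {a} {b} 0≤a 0≤b {f} extractor g (×-≡-dec Fin._≟_ Bool._≟_)
                                                        (cartesianProduct-enumerates (allFin-enumerates s) allBools-enumerates) p ⟩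
  N * (+ length edges * (b * 2^ d) + a * N)        ≡⟨ cong (λ l → N * (l * (b * 2^ d) + a * N)) (length-edges s) ⟩
  N * (+ s * + 2 * (b * 2^ d) + a * N)             ≡⟨ cong (λ t → N * (t + a * N)) (regroup (+ s) b (2^ d)) ⟩
  N * (b * + s * (+ 2 * 2^ d) + a * N)             ≤⟨ ℤ.*-monoˡ-≤-nonNeg N (ℤ.+-monoˡ-≤ (a * N)
                                                        (ℤ.*-monoʳ-≤-nonNeg (+ 2 * 2^ d) {{ℤ.nonNegative (*-nonNeg {+ 2} {2^ d} (ℤ.+≤+ z≤n) (ℤ.+≤+ z≤n))}} size≤)) ⟩
  N * (a * 2^ m * (+ 2 * 2^ d) + a * N)            ≡⟨ cong (λ t → N * (t + a * N)) (trans (regroup′ a (2^ m) (2^ d)) (cong (a *_) (sym N≡))) ⟩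
  N * (a * N + a * N)                              ≡⟨ cong (N *_) (double a N) ⟩
  N * (+ 2 * a * N)                                ∎
  where
  open import Data.Integer.Base using (_+_; _*_)
  open ℤ.≤-Reasoning
  N = 2^ (suc m ℕ.+ d)
  T = ∑ (allPoints (suc m ℕ.+ d)) (λ x → sign (f x xor g x))
  edges = cartesianProduct (allFin s) allBools
  -- The sign of a is read off from the size bound, whose left side is nonnegative.
  0≤a : 0ℤ ℤ.≤ a
  0≤a = ℤ.*-cancelʳ-≤-pos 0ℤ a (2^ m) {{ℤ.positive (ℤ.+<+ (ℕ.m^n>0 2 m))}}
          (ℤ.≤-trans (*-nonNeg 0≤b (ℤ.+≤+ z≤n)) size≤)
  N≡ : N ≡ + 2 * 2^ m * 2^ d
  N≡ = trans (cong +_ (ℕ.^-distribˡ-+-* 2 (suc m) d))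
    (trans (ℤ.pos-* (2 ℕ.^ suc m) (2 ℕ.^ d)) (cong (_* 2^ d) (ℤ.pos-* 2 (2 ℕ.^ m))))
  regroup : ∀ s b t → s * + 2 * (b * t) ≡ b * s * (+ 2 * t)
  regroup = solve-∀
  regroup′ : ∀ a u t → a * u * (+ 2 * t) ≡ a * (+ 2 * u * t)
  regroup′ = solve-∀
  double : ∀ a N → a * N + a * N ≡ + 2 * a * N
  double = solve-∀

-- From the total correlation to the distance

total+2card : ∀ {n} (f g : Cube n → Bool) →
  ∑ (allPoints n) (λ x → sign (f x xor g x)) ℤ.+ + 2 ℤ.* + card (λ x → f x xor g x) ≡ 2^ n
total+2card {n} f g = begin
  ∑ xs (sign ∘ h) ℤ.+ + 2 ℤ.* + card h             ≡⟨ cong (λ c → ∑ xs (sign ∘ h) ℤ.+ + 2 ℤ.* c) (card-length h) ⟩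
  ∑ xs (sign ∘ h) ℤ.+ + 2 ℤ.* ∑ xs (𝟙 ∘ h)         ≡⟨ cong (λ c → ∑ xs (sign ∘ h) ℤ.+ c) (∑-*ˡ xs (+ 2) (𝟙 ∘ h)) ⟨
  ∑ xs (sign ∘ h) ℤ.+ ∑ xs (λ x → + 2 ℤ.* 𝟙 (h x)) ≡⟨ ∑-+ xs _ _ ⟨
  ∑ xs (λ x → sign (h x) ℤ.+ + 2 ℤ.* 𝟙 (h x))      ≡⟨ ∑-cong xs (λ x → one (h x)) ⟩
  ∑ xs (λ _ → 1ℤ)                                  ≡⟨ ∑-points n 1ℤ ⟩
  2^ n ℤ.* 1ℤ                                      ≡⟨ ℤ.*-identityʳ _ ⟩
  2^ n                                             ∎
  where
  open ≡-Reasoning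
  xs = allPoints n
  h = λ x → f x xor g x
  one : ∀ b → sign b ℤ.+ + 2 ℤ.* 𝟙 b ≡ 1ℤ
  one false = refl
  one true  = refl

-- Definitionally 1/ ½, so that q lies below ½ ⊛ x when two * q lies below x.
two : ℚ
two = fromℤ (+ 2)

-- Here t is the normalised correlation T / 2^n, so the integer bound only has to be divided by the
-- denominator of e and by 4^n.
dist-square-bound : ∀ {n} (f g : Cube n → Bool) e →
  let T = ∑ (allPoints n) (λ x → sign (f x xor g x)) ; t = 1ℚ ℚ.- two ℚ.* dist f g in
  ↧ e ℤ.* (T ℤ.* T) ℤ.≤ 2^ n ℤ.* (+ 2 ℤ.* ↥ e ℤ.* 2^ n) → t ℚ.* t ℚ.≤ two ℚ.* e
dist-square-bound {n} f g e h = ℚ.*-cancelˡ-≤-pos (β * (ν * ν)) (begin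
  β * (ν * ν) * (t * t)                    ≡⟨ square β ν t ⟩
  β * ((ν * t) * (ν * t))                  ≡⟨ cong (λ x → β * (x * x)) νt≡T ⟩
  β * (fromℤ T * fromℤ T)                  ≡⟨ trans (fromℤ-* (↧ e) (T ℤ.* T)) (cong (β *_) (fromℤ-* T T)) ⟨
  fromℤ (↧ e ℤ.* (T ℤ.* T))                ≤⟨ fromℤ-mono-≤ h ⟩
  fromℤ (2^ n ℤ.* (+ 2 ℤ.* ↥ e ℤ.* 2^ n))
    ≡⟨ trans (fromℤ-* (2^ n) _) (cong (ν *_) (trans (fromℤ-* (+ 2 ℤ.* ↥ e) (2^ n)) (cong (_* ν) (fromℤ-* (+ 2) (↥ e))))) ⟩
  ν * (two * fromℤ (↥ e) * ν)              ≡⟨ cong (λ x → ν * (two * x * ν)) (*-↧ e) ⟨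
  ν * (two * (e * β) * ν)                  ≡⟨ regroup ν two e β ⟩
  β * (ν * ν) * (two * e)                  ∎)
  where
  open import Data.Rational.Base using (_*_; _+_)
  open ℚ.≤-Reasoning
  T = ∑ (allPoints n) (λ x → sign (f x xor g x))
  c = dist f g
  t = 1ℚ ℚ.- two * c
  β = fromℤ (↧ e)
  ν = fromℤ (2^ n)
  instance
    2^n≢0 = ℕ.m^n≢0 2 n
    β-pos = ℚ.positive {β} (ℚ.<-≤-trans (ℚ.positive⁻¹ 1ℚ) (fromℤ-mono-≤ {+ 1} (ℤ.+≤+ (s≤s z≤n))))
    ν-pos = ℚ.positive {ν} (ℚ.<-≤-trans (ℚ.positive⁻¹ 1ℚ) (fromℤ-mono-≤ (ℤ.+≤+ (ℕ.m^n>0 2 n))))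
    νν-pos = ℚ.pos*pos⇒pos ν ν
    βνν-pos = ℚ.pos*pos⇒pos β (ν * ν)
  count = + card (λ x → f x xor g x)
  open +-*-Solver
  square : ∀ β ν t → β * (ν * ν) * (t * t) ≡ β * ((ν * t) * (ν * t))
  square = solve 3 (λ β ν t → β :* (ν :* ν) :* (t :* t) := β :* ((ν :* t) :* (ν :* t))) refl
  regroup : ∀ ν w e β → ν * (w * (e * β) * ν) ≡ β * (ν * ν) * (w * e)
  regroup = solve 4 (λ ν w e β → ν :* (w :* (e :* β) :* ν) := β :* (ν :* ν) :* (w :* e)) refl
  expand : ∀ ν w c → ν * (1ℚ ℚ.- w * c) ≡ ν ℚ.- w * (c * ν)
  expand = solve 3 (λ ν w c → ν :* (con 1ℚ :- w :* c) := ν :- w :* (c :* ν)) refl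
  cancel : ∀ x y → x + y ℚ.- y ≡ x
  cancel = solve 2 (λ x y → x :+ y :- y := x) refl
  νt≡T : ν * t ≡ fromℤ T
  νt≡T = begin-equality
    ν * t                                    ≡⟨ expand ν two c ⟩
    ν ℚ.- two * (c * ν)                      ≡⟨ cong (λ x → ν ℚ.- two * x) (/-*-cancel count (2 ℕ.^ n)) ⟩
    ν ℚ.- two * fromℤ count                  ≡⟨ cong (λ x → fromℤ x ℚ.- two * fromℤ count) (total+2card f g) ⟨
    fromℤ (T ℤ.+ + 2 ℤ.* count) ℚ.- two * fromℤ count
      ≡⟨ cong (ℚ._- two * fromℤ count)
           (trans (fromℤ-+ T (+ 2 ℤ.* count)) (cong (λ x → fromℤ T + x) (fromℤ-* (+ 2) count))) ⟩
    fromℤ T + two * fromℤ count ℚ.- two * fromℤ count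
      ≡⟨ cancel (fromℤ T) (two * fromℤ count) ⟩
    fromℤ T                                  ∎

-- Were c ≤ q, then τ ≥ σ > 0, so τ² ≥ σ² > 2e.
<-from-square : ∀ {q c e} → let σ = 1ℚ ℚ.- two ℚ.* q ; τ = 1ℚ ℚ.- two ℚ.* c in
  0ℚ ℚ.< σ → e ℚ.< ½ ℚ.* (σ ℚ.* σ) → τ ℚ.* τ ℚ.≤ two ℚ.* e → q ℚ.< c
<-from-square {q} {c} {e} 0<σ e< τ²≤ = ℚ.≰⇒> λ c≤q →
  let σ≤τ : σ ℚ.≤ τ
      σ≤τ = ℚ.+-monoʳ-≤ 1ℚ (ℚ.neg-antimono-≤ (ℚ.*-monoˡ-≤-nonNeg two c≤q))
  in ℚ.<-irrefl refl (begin-strict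
    τ * τ                 ≤⟨ τ²≤ ⟩
    two * e               <⟨ ℚ.*-monoʳ-<-pos two e< ⟩
    two * (½ * (σ * σ))   ≡⟨ trans (sym (ℚ.*-assoc two ½ (σ * σ))) (ℚ.*-identityˡ (σ * σ)) ⟩
    σ * σ                 ≤⟨ ℚ.*-monoˡ-≤-nonNeg σ {{ℚ.nonNegative (ℚ.<⇒≤ 0<σ)}} σ≤τ ⟩
    σ * τ                 ≤⟨ ℚ.*-monoʳ-≤-nonNeg τ {{ℚ.nonNegative (ℚ.≤-trans (ℚ.<⇒≤ 0<σ) σ≤τ)}} σ≤τ ⟩
    τ * τ                 ∎)
  where
  open import Data.Rational.Base using (_*_)
  open ℚ.≤-Reasoning
  σ = 1ℚ ℚ.- two * q
  τ = 1ℚ ℚ.- two * c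

theorem16 : ∀ (n d : ℕ) (ε : ℝ) (f : Cube n → Bool) →
    DirectionalAffineExtractor d ε f →
    ε <ᴿ fromℚ ½ →
    ∀ (g : Cube n → Bool) (P : LBP n) →
    StronglyReadOnce P →
    Computes P g →
    fromℚ (+ LBP.size P / 1) ≤ᴿ ε *2^ (+ n - + d - + 1) →
    ½ ⊛ (1ℚ ⊖ √ ((+ 2 / 1) ⊛ ε)) ≤ᴿ fromℚ (dist f g)
-- For σ = 1 - 2q, membership of q in the lower cut of the left side unfolds to this pair: σ > 0,
-- and σ²/2 lies in the upper cut of ε.
theorem16 n d ε f extractor ε<½ g P readOnce computes size≤ q (0<s , ε<s²/2)
  with ℕ.m≤n⇒∃[o]m+o≡n (dimension-bound {n} {d} {ℕ.pred (LBP.size P)} {ε} ε<½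
         (subst (λ s → fromℚ (+ s / 1) ≤ᴿ ε *2^ (+ n - + d - + 1)) (sym (size≡suc (LBP.source P))) size≤))
  where
  size≡suc : ∀ {k} → Fin k → suc (ℕ.pred k) ≡ k
  size≡suc {suc k} _ = refl
-- The variables number `suc m + d`: φ consists of `suc m` forms, and the exponent n - d - 1 is m.
... | m , eq with trans (cong suc (ℕ.+-comm m d)) eq
...   | refl = decidable-stable (q ℚ.<? dist f g) λ q≮ →
  ¬¬partition {suc m} {d} P (s≤s z≤n) readOnce computes λ p →
    -- Openness of the cut yields a rational e strictly between ε and σ²/2. Its numerator and
    -- denominator are the a and b of the integer bounds, and e < σ²/2 makes the final comparison
    -- strict.
    let (e , e<s²/2 , ε<e) = ℝ.U-open ε ε<s²/2
    in q≮ (<-from-square {q} {dist f g} {e} 0<s e<s²/2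
         (dist-square-bound f g e
           (total-correlation {m} {d} {↥ e} {↧ e} {f = f} (ℤ.+≤+ z≤n) (directionalBound {ε = ε} {f} {e} extractor ε<e)
             (integral-size-bound {m} {d} {LBP.size P} {ε} {e} size≤ ε<e) p)))
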